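{- An equivalence structure $\mathfrak A$ is a Presburger structure if, and only if, $\mathfrak A \cong \mathfrak E(g) + \mathfrak C$ where $g$ is a generalised vector partition function and $\mathfrak C$ is a countable equivalence structure with only infinite classes. Here $+$ denotes the disjoint union of equivalence structures.
   Context: An equivalence structure is a structure of the form $\langle A,\sim\rangle$ where $\sim$ is an equivalence relation on $A$. Given a function $g$ on $\mathbb N^n$ with values in $\mathbb N\cup\{\infty\}$, $\mathfrak E(g)$ denotes the equivalence structure (unique up to isomorphism) with exactly $|g^{ -1}(k)|$ classes of size $k$, for each $k \in (\mathbb N\setminus\{0\})\cup\{\infty\}$, and no other classes; arguments mapped to $0$ contribute no class. A $k$-dimensional first-order interpretation is a list of first-order formulae $\tau = \langle \delta(\bar x), (\varphi_R(\bar x_0,\dots,\bar x_{n_R-1}))_{R}\rangle$, where $n_R$ is the arity of the relation symbol $R$ and $\bar x,\bar x_i$ are $k$-tuples of variables. Applied to a structure $\mathfrak M$ it defines the structure $\tau(\mathfrak M)$ with universe $\{\bar a \in M^k : \mathfrak M\models\delta(\bar a)\}$ and relations $\{\langle \bar a_0,\dots,\bar a_{n_R-1}\rangle \in M^{kn_R} : \mathfrak M \models \varphi_R(\bar a_0,\dots,\bar a_{n_R-1})\}$. A Presburger structure is a structure that is isomorphic to $\tau(\langle\mathbb N,+\rangle)$ for some $k$ and some $k$-dimensional first-order interpretation $\tau$. For a matrix $A \in \mathbb N^{n\times m}$, the vector partition function $\psi_A : \mathbb N^n\to\mathbb N$ associated with $A$ maps a tuple $\bar x\in\mathbb N^n$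 to the number of tuples $\bar y\in\mathbb N^m$ such that $\bar x = A\bar y$. (Not every matrix has an associated vector partition function, since the equation $\bar x = A\bar y$ might have infinitely many solutions.) A generalised vector partition function is a function $g:\mathbb N^n\to\mathbb N$ of the form $g(\bar x) = \sum_{i<s}\psi_{A_i}(\bar x+\bar c_i)$ with $A_i\in\mathbb N^{n\times m_i}$ and $\bar c_i\in\mathbb N^n$.
   Formalization: The shifts c_i range over ℤⁿ instead of ℕⁿ, with ψ_A taken as 0 at tuples with a negative entry; with c_i in ℕⁿ the claim is false: two singleton classes form a Presburger structure, but a g of finite support would vanish outside 0. -}

module Defs where

open import Level using (0ℓ)
open import Data.Nat.Base using (ℕ; suc; _+_; _*_)
open import Data.Integer.Base as ℤ using (ℤ; +_; -[1+_])
open import Data.Fin.Base using (Fin)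
open import Data.Product.Base using (Σ; ∃; _×_; proj₁)
open import Data.Refinement.Base using (Refinement; Refinement-syntax; value)
open import Data.Sum.Base using (_⊎_)
open import Data.Sum.Relation.Binary.Pointwise using (_⊎ₛ_)
open import Data.Unit.Base using (⊤; tt)
open import Data.Vec.Base using (Vec; []; _∷_; map; zipWith; lookup; sum; tabulate; concat)
open import Function.Base using (_∘_)
open import Function.Bundles using (_↔_; _↣_; _⇔_; Inverse)
open import Relation.Binary.Bundles using (Setoid)
import Relation.Binary.Construct.On as On
open import Relation.Binary.PropositionalEquality using (_≡_)
open import Relation.Binary.PropositionalEquality.Properties using (setoid)
open import Relation.Nullary.Negation using (¬_)

------------------------------------------------------------------------
-- Relational structures

record Signature : Set₁ where
  field
    Symbol : Set
    arity  : Symbol → ℕ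

open Signature public

-- Equality of elements of a structure is propositional equality.
record Structure (σ : Signature) : Set₁ where
  field
    Carrier : Set
    ⟦_⟧     : (R : Symbol σ) → Vec Carrier (arity σ R) → Set

record _≅_ {σ : Signature} (𝔐 𝔑 : Structure σ) : Set where
  private
    module M = Structure 𝔐
    module N = Structure 𝔑
  field
    bijection : M.Carrier ↔ N.Carrier
    preserves : ∀ R (xs : Vec M.Carrier (arity σ R)) →
                M.⟦ R ⟧ xs ⇔ N.⟦ R ⟧ (map (Inverse.to bijection) xs)

infix 4 _≅_

------------------------------------------------------------------------
-- First-order logic over ⟨ℕ,+⟩

data Term (n : ℕ) : Set where
  var : Fin n → Term n
  _⊕_ : Term n → Term n → Term n

-- `Formula n` has its free variables in `Fin n`; a quantifier binds
-- variable `zero` of its body (de Bruijn indices).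
data Formula (n : ℕ) : Set where
  _≐_       : Term n → Term n → Formula n
  ¬′_       : Formula n → Formula n
  _∧′_ _∨′_ : Formula n → Formula n → Formula n
  ∃′_ ∀′_   : Formula (suc n) → Formula n

eval : ∀ {n} → Vec ℕ n → Term n → ℕ
eval ρ (var i) = lookup ρ i
eval ρ (s ⊕ t) = eval ρ s + eval ρ t

infix 4 _⊨_

_⊨_ : ∀ {n} → Vec ℕ n → Formula n → Set
ρ ⊨ (s ≐ t)  = eval ρ s ≡ eval ρ t
ρ ⊨ (¬′ φ)   = ¬ (ρ ⊨ φ)
ρ ⊨ (φ ∧′ ψ) = (ρ ⊨ φ) × (ρ ⊨ ψ)
ρ ⊨ (φ ∨′ ψ) = (ρ ⊨ φ) ⊎ (ρ ⊨ ψ)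
ρ ⊨ (∃′ φ)   = ∃ λ x → (x ∷ ρ) ⊨ φ
ρ ⊨ (∀′ φ)   = ∀ x → (x ∷ ρ) ⊨ φ

------------------------------------------------------------------------
-- Interpretations in ⟨ℕ,+⟩ and Presburger structures

record Interpretation (σ : Signature) (k : ℕ) : Set where
  field
    δ : Formula k
    φ : (R : Symbol σ) → Formula (arity σ R * k)

-- The refinement type carries its proof of δ irrelevantly, so elements
-- of the interpreted structure are equal as soon as the tuples are.
interpret : ∀ {σ k} → Interpretation σ k → Structure σ
interpret {k = k} τ = record
  { Carrier = [ a ∈ Vec ℕ k ∣ a ⊨ δ ]
  ; ⟦_⟧     = λ R as → concat (map value as) ⊨ φ R
  }
  where open Interpretation τ

IsPresburger : ∀ {σ} → Structure σ → Set
IsPresburger {σ} 𝔐 = ∃ λ k → Σ (Interpretation σ k) λ τ → 𝔐 ≅ interpret τ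

------------------------------------------------------------------------
-- Equivalence structures

-- A setoid is read as the structure ⟨Carrier , _≈_⟩: here _≈_ is the
-- relation ∼, and elements are still compared by _≡_.
EquivalenceStructure : Set₁
EquivalenceStructure = Setoid 0ℓ 0ℓ

∼-signature : Signature
∼-signature = record { Symbol = ⊤ ; arity = λ _ → 2 }

structure : EquivalenceStructure → Structure ∼-signature
structure 𝔄 = record
  { Carrier = Carrier
  ; ⟦_⟧     = λ { tt (x ∷ y ∷ []) → x ≈ y }
  }
  where open Setoid 𝔄

HasSize : Set → ℕ → Set
HasSize X n = X ↔ Fin n

-- Every x̄ contributes one class, {x̄} × Fin (g x̄), which is no class at
-- all when g x̄ = 0.
𝔈 : ∀ {n} → (Vec ℕ n → ℕ) → EquivalenceStructure
𝔈 {n} g = On.setoid {B = Σ (Vec ℕ n) (Fin ∘ g)} (setoid (Vec ℕ n)) proj₁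

-- The disjoint union: elements of different summands are unrelated.
_+ₑ_ : EquivalenceStructure → EquivalenceStructure → EquivalenceStructure
𝔄 +ₑ 𝔅 = 𝔄 ⊎ₛ 𝔅

Countable : EquivalenceStructure → Set
Countable ℭ = Setoid.Carrier ℭ ↣ ℕ

OnlyInfiniteClasses : EquivalenceStructure → Set
OnlyInfiniteClasses ℭ = ∀ x → ¬ ∃ (HasSize [ y ∈ Carrier ∣ x ≈ y ])
  where open Setoid ℭ

------------------------------------------------------------------------
-- Vector partition functions

Matrix : ℕ → ℕ → Set
Matrix n m = Vec (Vec ℕ m) n

_*ᵥ_ : ∀ {n m} → Matrix n m → Vec ℕ m → Vec ℕ n
A *ᵥ y = map (λ row → sum (zipWith _*_ row y)) A

-- A matrix admits such a ψ only if all its fibres are finite.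
IsVectorPartitionFunction : ∀ {n m} → Matrix n m → (Vec ℕ n → ℕ) → Set
IsVectorPartitionFunction {m = m} A ψ =
  ∀ x → HasSize [ y ∈ Vec ℕ m ∣ x ≡ A *ᵥ y ] (ψ x)

-- x = A y has no solution y when x has a negative entry.
zeroExtend : ∀ {n} → (Vec ℕ n → ℕ) → Vec ℤ n → ℕ
zeroExtend ψ []               = ψ []
zeroExtend ψ (+ k ∷ z)        = zeroExtend (ψ ∘ (k ∷_)) z
zeroExtend ψ (-[1+ _ ] ∷ z)   = 0

-- The shifts c have to range over ℤⁿ.  If all of them were in ℕⁿ, a
-- function g of finite support would vanish outside 0: A y = x + c ≠ 0
-- yields the support points k · A y - c for all k ≥ 1.  Then the
-- two-element structure with two classes, which is Presburger, would not
-- be of the form 𝔈 g + ℭ.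
record IsGeneralisedVPF {n : ℕ} (g : Vec ℕ n → ℕ) : Set where
  field
    s     : ℕ
    m     : Fin s → ℕ
    A     : ∀ i → Matrix n (m i)
    c     : Fin s → Vec ℤ n
    ψ     : Fin s → Vec ℕ n → ℕ
    isVPF : ∀ i → IsVectorPartitionFunction (A i) (ψ i)
    g≡∑   : ∀ x → g x ≡ sum (tabulate λ i →
              zeroExtend (ψ i) (zipWith (λ a b → + a ℤ.+ b) x (c i)))

{-# OPTIONS --safe #-}

-- Call two points of ℕⁿ similar if they are congruent modulo M and give the same sign (−, 0 or +) to each
-- form of a finite list of integer affine forms.  Sets that are unions of similarity classes are closed under
-- Boolean operations, and under projection by a one-step back-and-forth argument: z can be lowered in steps
-- of M until some form a z + t is small, and then z is determined by t and finitely many data.  Hence every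
-- definable set is of this kind.  Given M and the forms, ℕⁿ is cut into finitely many injective affine images
-- of ℕᵈ that lie in a single similarity class, by splitting pairs of generators of opposite sign as in the
-- Euclidean algorithm.  So every definable set is a finite disjoint union of injective affine images.
--
-- Applied to the pairs (x , a) where x is the least element of the finite class of a, this exhibits the size
-- of the class of x as the number of solutions y of the systems x = b + A y.  Conversely, the solutions y of
-- the systems defining g are themselves the elements of an interpreted structure.

module Submission where

open import Defs
open import Level using (0ℓ)
open import Axiom.ExcludedMiddle using (ExcludedMiddle)
open import Axiom.UniquenessOfIdentityProofs using (module Decidable⇒UIP)
open import Data.Bool.Base using (Bool; true; false)
open import Data.Empty using (⊥)
open import Data.Fin.Base as Fin using (Fin; zero; suc; toℕ; fromℕ<; _↑ˡ_; _↑ʳ_)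
import Data.Fin.Properties as Fin
open import Data.Integer.Base as ℤ using (ℤ; +_; -[1+_]; +[1+_]; ∣_∣; 0ℤ; 1ℤ; -1ℤ)
import Data.Integer.Properties as ℤ
open import Data.Integer.Tactic.RingSolver using (solve-∀)
open import Data.Irrelevant using ([_])
open import Data.List.Base as List using (List; []; _∷_; upTo; concatMap)
open import Data.List.Membership.Propositional using (_∈_; lose)
open import Data.List.Membership.Propositional.Properties
  using (∈-map⁺; ∈-concatMap⁺; ∈-++⁺ˡ; ∈-++⁺ʳ; ∈-upTo⁺)
import Data.List.Relation.Unary.All as List-All
import Data.List.Relation.Unary.All.Properties as List-All
open import Data.List.Relation.Unary.Any using (here; there)
open import Data.Nat.Base
  using (ℕ; zero; suc; _+_; _*_; _≤_; _<_; z≤n; s≤s; s≤s⁻¹; NonZero; >-nonZero⁻¹; compare; less; equal; greater)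
open import Data.Nat.DivMod using (_/_; _%_; m≡m%n+[m/n]*n; m%n<n; [m+kn]%n≡m%n; m<n⇒m%n≡m)
open import Data.Nat.Divisibility using (_∣_; divides; m∣m*n; n∣m*n; ∣n⇒∣m*n; *-monoʳ-∣; ∣-refl; ∣-trans)
open import Data.Nat.ListAction using (product)
open import Data.Nat.ListAction.Properties using (∈⇒∣product; product≢0)
import Data.Nat.Properties as ℕ
import Data.Nat.Tactic.RingSolver as ℕ-Solver
open import Data.Product.Algebra using (×-cong)
open import Data.Product.Base using (Σ; ∃; _×_; _,_; proj₁; proj₂; uncurry)
open import Data.Product.Function.Dependent.Propositional using (Σ-↔)
open import Data.Product.Properties using (,-injectiveʳ-UIP)
open import Data.Refinement.Base using (Refinement; _,_; value)
open import Data.Sum.Algebra using (⊎-cong)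
open import Data.Sum.Base as Sum using (_⊎_; inj₁; inj₂; [_,_]′)
open import Data.Sum.Relation.Binary.Pointwise using (inj₁; inj₂)
open import Data.Unit.Base using (⊤; tt)
open import Data.Vec.Base as Vec
  using (Vec; []; _∷_; zipWith; lookup; replicate; map; sum; tabulate; take; drop; truncate; padRight)
import Data.Vec.Properties as Vec
open import Data.Vec.Relation.Binary.Pointwise.Inductive as Pointwise using (Pointwise; []; _∷_)
open import Data.Vec.Relation.Unary.All as All using (All; []; _∷_)
open import Function.Base using (_∘_; id)
open import Function.Bundles
  using (_↔_; _↣_; _⇔_; mk↔ₛ′; mk↣; mk⇔; Inverse; Injection; Equivalence)
open import Function.Construct.Composition using (_↔-∘_)
open import Function.Construct.Identity using (↔-id)
open import Function.Construct.Symmetry using (↔-sym)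
open import Relation.Binary.Bundles using (Setoid)
open import Relation.Binary.Definitions using (tri<; tri≈; tri>)
open import Relation.Binary.PropositionalEquality hiding ([_]; J)
open import Relation.Nullary using (¬_; Dec; yes; no; contradiction)
open import Relation.Nullary.Decidable using (decidable-stable)
open import Relation.Nullary.Decidable.Core using (recompute)

-- Counting dictates the shape of the argument. The elements of a finite class must be counted
-- exactly once, so overlapping affine images would not do: the pieces have to be disjoint and each
-- affine map injective. Both requirements are kept as a single bijection of parameters, which
-- composes under repeated splitting. Finiteness of a class is not directly a first-order condition,
-- but a class inside ℕᵏ is finite exactly if it is bounded, and boundedness is expressible; this
-- makes the set of pairs (x , a) definable. A matrix counts solutions only if its fibres are
-- finite, and they are, because a fibre parametrises injectively some elements of one bounded
-- class. The splitting of generators of opposite sign is made to terminate by a prior split into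
-- residues, after which all nonzero values of the form on the generators have the same absolute
-- value.

-- Bijections and finite types

infixr 9 _⨾_
_⨾_ : ∀ {A B C : Set} → A ↔ B → B ↔ C → A ↔ C
f ⨾ g = g ↔-∘ f

↔-subst : ∀ {A : Set} (B : A → Set) {x y : A} → x ≡ y → B x ↔ B y
↔-subst B refl = ↔-id _

Σ-assoc-↔ : ∀ {A : Set} {B : A → Set} {C : Σ A B → Set} →
            Σ A (λ a → Σ (B a) λ b → C (a , b)) ↔ Σ (Σ A B) C
Σ-assoc-↔ = mk↔ₛ′ (λ (a , b , c) → (a , b) , c) (λ ((a , b) , c) → a , b , c) (λ _ → refl) (λ _ → refl)

Σ-cong₂-↔ : ∀ {A : Set} {B C : A → Set} → (∀ a → B a ↔ C a) → Σ A B ↔ Σ A C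
Σ-cong₂-↔ f = Σ-↔ (↔-id _) (f _)

Σ-Fin-suc-↔ : ∀ {n} {B : Fin (suc n) → Set} → Σ (Fin (suc n)) B ↔ (B zero ⊎ Σ (Fin n) (B ∘ suc))
Σ-Fin-suc-↔ = mk↔ₛ′
  (λ { (zero , b) → inj₁ b ; (suc i , b) → inj₂ (i , b) })
  (λ { (inj₁ b) → zero , b ; (inj₂ (i , b)) → suc i , b })
  (λ { (inj₁ b) → refl ; (inj₂ (i , b)) → refl })
  (λ { (zero , b) → refl ; (suc i , b) → refl })

Σ-Fin-↔ : ∀ {n} (f : Fin n → ℕ) → Σ (Fin n) (Fin ∘ f) ↔ Fin (sum (tabulate f))
Σ-Fin-↔ {zero}  f = mk↔ₛ′ (λ ()) (λ ()) (λ ()) (λ ())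
Σ-Fin-↔ {suc n} f = Σ-Fin-suc-↔ ⨾ ⊎-cong (↔-id _) (Σ-Fin-↔ (f ∘ suc)) ⨾ ↔-sym Fin.+↔⊎

refinement-≡ : ∀ {A : Set} {P : A → Set} {r s : Refinement A P} → value r ≡ value s → r ≡ s
refinement-≡ refl = refl

refined : ∀ {A : Set} {P : A → Set} (a : A) → .(P a) → Refinement A P
refined a p = a , [ p ]

Finite : Set → Set
Finite X = ∃ (HasSize X)

Finite-↔ : ∀ {X Y : Set} → X ↔ Y → Finite X → Finite Y
Finite-↔ f (n , g) = n , ↔-sym f ⨾ g

Finite-Fin : ∀ {n} → Finite (Fin n)
Finite-Fin = _ , ↔-id _

Finite-⊤ : Finite ⊤
Finite-⊤ = 1 , mk↔ₛ′ (λ _ → zero) (λ _ → tt) (λ { zero → refl }) (λ _ → refl)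

Finite-⊎ : ∀ {X Y : Set} → Finite X → Finite Y → Finite (X ⊎ Y)
Finite-⊎ (m , f) (n , g) = m + n , ⊎-cong f g ⨾ ↔-sym Fin.+↔⊎

Finite-Σ : ∀ {X : Set} {Y : X → Set} → Finite X → (∀ x → Finite (Y x)) → Finite (Σ X Y)
Finite-Σ {X} {Y} (n , f) fin =
  _ , ↔-sym (Σ-↔ {B = Y} (↔-sym f) (↔-id _)) ⨾ Σ-cong₂-↔ (λ i → proj₂ (fin (from i))) ⨾ Σ-Fin-↔ _
  where open Inverse f using (from)

∷-↔ : ∀ {A : Set} {n} → (A × Vec A n) ↔ Vec A (suc n)
∷-↔ = mk↔ₛ′ (uncurry _∷_) (λ v → Vec.head v , Vec.tail v) (λ { (a ∷ as) → refl }) (λ _ → refl)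

Finite-Vec : ∀ {X : Set} → Finite X → ∀ n → Finite (Vec X n)
Finite-Vec fin zero    = Finite-↔ (mk↔ₛ′ (λ _ → []) (λ _ → tt) (λ { [] → refl }) (λ _ → refl)) Finite-⊤
Finite-Vec fin (suc n) = Finite-↔ ∷-↔ (Finite-Σ fin λ _ → Finite-Vec fin n)

-- 2^a (2b + 1)
pair : ℕ → ℕ → ℕ
pair zero    b = suc (b + b)
pair (suc a) b = pair a b + pair a b

double≢suc-double : ∀ a b → ¬ (a + a ≡ suc (b + b))
double≢suc-double (suc a) (suc b) eq =
  double≢suc-double a b (ℕ.suc-injective (ℕ.suc-injective
    (trans (cong suc (sym (ℕ.+-suc a a))) (trans eq (cong (λ k → suc (suc k)) (ℕ.+-suc b b))))))
double≢suc-double (suc a) zero eq = contradiction (trans (sym (ℕ.+-suc a a)) (ℕ.suc-injective eq)) λ ()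

double-injective : ∀ a b → a + a ≡ b + b → a ≡ b
double-injective zero    zero    eq = refl
double-injective (suc a) (suc b) eq = cong suc (double-injective a b
  (ℕ.suc-injective (trans (sym (ℕ.+-suc a a)) (trans (ℕ.suc-injective eq) (ℕ.+-suc b b)))))

pair-injective : ∀ {a b c d} → pair a b ≡ pair c d → a ≡ c × b ≡ d
pair-injective {zero}  {b} {zero}  {d} eq = refl , double-injective b d (ℕ.suc-injective eq)
pair-injective {zero}  {b} {suc c} {d} eq = contradiction (sym eq) (double≢suc-double (pair c d) b)
pair-injective {suc a} {b} {zero}  {d} eq = contradiction eq (double≢suc-double (pair a b) d)
pair-injective {suc a} {b} {suc c} {d} eq with pair-injective {a} {b} {c} {d} (double-injective _ _ eq)
... | refl , b≡d = refl , b≡d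

encode : ∀ {n} → Vec ℕ n → ℕ
encode []       = 0
encode (x ∷ xs) = pair x (encode xs)

encode-injective : ∀ {n} {x y : Vec ℕ n} → encode x ≡ encode y → x ≡ y
encode-injective {x = []}     {[]}     eq = refl
encode-injective {x = x ∷ xs} {y ∷ ys} eq with pair-injective {x} {_} {y} eq
... | refl , eq′ = cong (x ∷_) (encode-injective eq′)

-- Finiteness and countability under excluded middle

module Classical (em : ExcludedMiddle 0ℓ) where

  -- The proof inside a refinement is irrelevant, but excluded middle decides `P`, and `recompute`
  -- then returns a usable proof.
  holds : ∀ {A : Set} {P : A → Set} (r : Refinement A P) → P (value r)
  holds (a , [ p ]) = recompute em p

  -- Under an injection a point has at most one preimage, so whatever `complete` returns is the
  -- inverse. Several carriers below are identified in this way.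
  image-↔ : ∀ {A B : Set} {P : B → Set} (f : A → B) → (∀ {a a′} → f a ≡ f a′ → a ≡ a′) →
            (∀ a → P (f a)) → (∀ b → P b → ∃ λ a → f a ≡ b) → A ↔ Refinement B P
  image-↔ f inj sound complete = mk↔ₛ′
    (λ a → refined (f a) (sound a))
    (λ r → proj₁ (complete (value r) (holds r)))
    (λ r → refinement-≡ (proj₂ (complete (value r) (holds r))))
    (λ a → inj (proj₂ (complete (f a) _)))

  Refinement-cong-↔ : ∀ {A : Set} {P Q : A → Set} → (∀ a → P a → Q a) → (∀ a → Q a → P a) →
                      Refinement A P ↔ Refinement A Q
  Refinement-cong-↔ f g = mk↔ₛ′ (λ r → refined (value r) (f _ (holds r)))
    (λ r → refined (value r) (g _ (holds r))) (λ _ → refl) (λ _ → refl)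

  Finite-Refinement-Fin : ∀ {n} (P : Fin n → Set) → Finite (Refinement (Fin n) P)
  Finite-Refinement-Fin {zero}  P = 0 , mk↔ₛ′ (λ ()) (λ ()) (λ ()) (λ ())
  Finite-Refinement-Fin {suc n} P with Finite-Refinement-Fin (P ∘ suc) | em {P zero}
  ... | fin | yes p = Finite-↔ (image-↔
                        [ (λ _ → zero) , suc ∘ value ]′
                        (λ { {inj₁ _} {inj₁ _} _ → refl
                           ; {inj₂ r} {inj₂ s} eq → cong inj₂ (refinement-≡ (Fin.suc-injective eq)) })
                        (λ { (inj₁ _) → p ; (inj₂ r) → holds r })
                        (λ { zero _ → inj₁ tt , refl ; (suc i) q → inj₂ (refined i q) , refl }))
                        (Finite-⊎ Finite-⊤ fin)
  ... | fin | no ¬p = Finite-↔ (image-↔ (suc ∘ value) (refinement-≡ ∘ Fin.suc-injective) holds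
                        (λ { zero q → contradiction q ¬p ; (suc i) q → refined i q , refl })) fin

  Finite-injection : ∀ {X Y : Set} → Finite Y → (f : X → Y) → (∀ {x x′} → f x ≡ f x′ → x ≡ x′) → Finite X
  Finite-injection (n , g) f inj = Finite-↔
    (↔-sym (image-↔ {P = λ i → ∃ λ x → to (f x) ≡ i} (to ∘ f) (inj ∘ to-injective) (λ x → x , refl) (λ _ e → e)))
    (Finite-Refinement-Fin _)
    where
    open Inverse g using (to; from; strictlyInverseʳ)
    to-injective : ∀ {y y′} → to y ≡ to y′ → y ≡ y′
    to-injective eq = trans (sym (strictlyInverseʳ _)) (trans (cong from eq) (strictlyInverseʳ _))

  Finite-bounded : ∀ {n} {X : Set} B (f : X → Vec ℕ n) → (∀ {x x′} → f x ≡ f x′ → x ≡ x′) →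
                   (∀ x → All (_≤ B) (f x)) → Finite X
  Finite-bounded {n} {X} B f inj bounded = Finite-injection (Finite-Vec (Finite-Fin {suc B}) n)
    (λ x → clip (f x) (bounded x)) (λ eq → inj (clip-injective _ _ eq))
    where
    clip : ∀ {n} (v : Vec ℕ n) → All (_≤ B) v → Vec (Fin (suc B)) n
    clip []      []       = []
    clip (x ∷ v) (p ∷ ps) = fromℕ< (s≤s p) ∷ clip v ps

    clip-injective : ∀ {n} {v w : Vec ℕ n} (p : All (_≤ B) v) (q : All (_≤ B) w) →
                         clip v p ≡ clip w q → v ≡ w
    clip-injective []       []       eq = refl
    clip-injective (p ∷ ps) (q ∷ qs) eq = cong₂ _∷_
      (Fin.fromℕ<-injective _ _ (s≤s p) (s≤s q) (cong Vec.head eq))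
      (clip-injective ps qs (cong Vec.tail eq))

  least : (S : ℕ → Set) → ∃ S → ∃ λ m → S m × (∀ k → S k → m ≤ k)
  least S (n , s) = go n 0 (λ k ()) (subst S (sym (ℕ.+-identityʳ n)) s)
    where
    -- `d` is the distance from the candidate `a` up to the known witness `d + a`; nothing below `a`
    -- lies in `S`.
    go : ∀ d a → (∀ k → k < a → ¬ S k) → S (d + a) → ∃ λ m → S m × (∀ k → S k → m ≤ k)
    go d a below s with em {S a}
    ... | yes p = a , p , λ k q → ℕ.≮⇒≥ (λ k<a → below k k<a q)
    go zero    a below s | no ¬p = contradiction s ¬p
    go (suc d) a below s | no ¬p = go d (suc a)
      (λ k k<1+a q → [ (λ k<a → below k k<a q) , (λ { refl → ¬p q }) ]′ (ℕ.m≤n⇒m<n∨m≡n (s≤s⁻¹ k<1+a)))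
      (subst S (sym (ℕ.+-suc d a)) s)

  module _ (S : ℕ → Set) (unbounded : ∀ b → ∃ λ n → S n × b ≤ n) where
    private
      next : ∀ b → ∃ λ m → (S m × b ≤ m) × (∀ k → S k × b ≤ k → m ≤ k)
      next b = least (λ n → S n × b ≤ n) (unbounded b)

      enum : ℕ → ℕ
      enum zero    = proj₁ (next 0)
      enum (suc k) = proj₁ (next (suc (enum k)))

      indicator : ∀ {P : Set} → Dec P → ℕ
      indicator (yes _) = 1
      indicator (no  _) = 0

      count : ℕ → ℕ
      count zero    = 0
      count (suc n) = indicator (em {S n}) + count n

      count-∈ : ∀ {n} → S n → count (suc n) ≡ suc (count n)
      count-∈ {n} s with em {S n}
      ... | yes _ = refl
      ... | no ¬s = contradiction s ¬s

      count-∉ : ∀ {n} → ¬ S n → count (suc n) ≡ count n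
      count-∉ {n} ¬s with em {S n}
      ... | yes s = contradiction s ¬s
      ... | no _  = refl

      count-mono : ∀ {m n} → m ≤ n → count m ≤ count n
      count-mono {m} {n} m≤n with ℕ.m≤n⇒m<n∨m≡n m≤n
      ... | inj₂ refl = ℕ.≤-refl
      count-mono {m} {suc n} m≤n | inj₁ m<n = ℕ.≤-trans (count-mono (s≤s⁻¹ m<n)) (ℕ.m≤n+m _ _)

      count-injective : ∀ {m n} → S m → S n → count m ≡ count n → m ≡ n
      count-injective {m} {n} s t eq with ℕ.<-cmp m n
      ... | tri≈ _ m≡n _ = m≡n
      ... | tri< m<n _ _ = contradiction (ℕ.≤-trans (ℕ.≤-reflexive (sym (count-∈ s))) (count-mono m<n))
                                         (ℕ.<-irrefl eq)
      ... | tri> _ _ n<m = contradiction (ℕ.≤-trans (ℕ.≤-reflexive (sym (count-∈ t))) (count-mono n<m))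
                                         (ℕ.<-irrefl (sym eq))

      count-gap : ∀ d b → (∀ k → S k → b ≤ k → d + b ≤ k) → count (d + b) ≡ count b
      count-gap zero    b gap = refl
      count-gap (suc d) b gap = trans
        (count-∉ (λ s → ℕ.<-irrefl refl (gap (d + b) s (ℕ.m≤n+m b d))))
        (count-gap d b (λ k s b≤k → ℕ.<⇒≤ (gap k s b≤k)))

      count-next : ∀ b → count (proj₁ (next b)) ≡ count b
      count-next b with next b
      ... | m , (s , b≤m) , min with ℕ.m≤n⇒∃[o]m+o≡n b≤m
      ... | d , refl = trans (cong count (ℕ.+-comm b d))
                             (count-gap d b (λ k s b≤k → ℕ.≤-trans (ℕ.≤-reflexive (ℕ.+-comm d b)) (min k (s , b≤k))))

      enum-∈ : ∀ k → S (enum k)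
      enum-∈ zero    = proj₁ (proj₁ (proj₂ (next 0)))
      enum-∈ (suc k) = proj₁ (proj₁ (proj₂ (next (suc (enum k)))))

      count-enum : ∀ k → count (enum k) ≡ k
      count-enum zero    = count-next 0
      count-enum (suc k) = trans (count-next (suc (enum k)))
        (trans (count-∈ (enum-∈ k)) (cong suc (count-enum k)))

    -- `enum k` is the k-th element of `S`, counted from 0, and `count n` the number of elements
    -- below `n`. One inverse law is `count-enum`; the other holds because `count` is injective on
    -- `S`.
    unbounded-↔-ℕ : Refinement ℕ S ↔ ℕ
    unbounded-↔-ℕ = mk↔ₛ′ (λ r → count (value r)) (λ k → refined (enum k) (enum-∈ k)) count-enum
      (λ r → refinement-≡ (count-injective (enum-∈ (count (value r))) (holds r) (count-enum _)))

  countable-↔ : ∀ {X : Set} → X ↣ ℕ → Finite X ⊎ (X ↔ ℕ)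
  countable-↔ {X} f with em {∃ λ b → ∀ x → Injection.to f x ≤ b}
  ... | yes (b , bounded) = inj₁ (Finite-bounded b (λ x → to x ∷ []) (injective ∘ cong Vec.head) (λ x → bounded x ∷ []))
    where open Injection f using (to; injective)
  ... | no ¬bounded = inj₂ (image-↔ {P = S} to injective (λ x → x , refl) (λ _ e → e) ⨾ unbounded-↔-ℕ S unbounded)
    where
    open Injection f using (to; injective)
    S : ℕ → Set
    S n = ∃ λ x → to x ≡ n
    unbounded : ∀ b → ∃ λ n → S n × b ≤ n
    unbounded b with em {∃ λ n → S n × b ≤ n}
    ... | yes u = u
    ... | no ¬u = contradiction (b , λ x → ℕ.≮⇒≥ (λ b<x → ¬u (to x , (x , refl) , ℕ.<⇒≤ b<x))) ¬bounded

-- Signs of integers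

-- Integer values make `sgn` multiplicative, so that a nonzero factor can be cancelled from an
-- equation between signs.
sgn : ℤ → ℤ
sgn (+ 0)    = 0ℤ
sgn +[1+ _ ] = 1ℤ
sgn -[1+ _ ] = -1ℤ

sgn-* : ∀ i j → sgn (i ℤ.* j) ≡ sgn i ℤ.* sgn j
sgn-* (+ 0)    j        = refl
sgn-* +[1+ m ] (+ 0)    = cong sgn (ℤ.*-zeroʳ +[1+ m ])
sgn-* +[1+ m ] +[1+ n ] = refl
sgn-* +[1+ m ] -[1+ n ] = refl
sgn-* -[1+ m ] (+ 0)    = cong sgn (ℤ.*-zeroʳ -[1+ m ])
sgn-* -[1+ m ] +[1+ n ] = refl
sgn-* -[1+ m ] -[1+ n ] = refl

sgn-neg : ∀ i → sgn (ℤ.- i) ≡ ℤ.- sgn i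
sgn-neg (+ 0)    = refl
sgn-neg +[1+ _ ] = refl
sgn-neg -[1+ _ ] = refl

sgn-*-cancel : ∀ i {j k} → i ≢ 0ℤ → sgn (i ℤ.* j) ≡ sgn (i ℤ.* k) → sgn j ≡ sgn k
sgn-*-cancel (+ 0)    i≢0 eq = contradiction refl i≢0
sgn-*-cancel +[1+ m ] {j} {k} i≢0 eq = trans (sym (ℤ.*-identityˡ _)) (trans (sym (sgn-* +[1+ m ] j))
  (trans eq (trans (sgn-* +[1+ m ] k) (ℤ.*-identityˡ _))))
sgn-*-cancel -[1+ m ] {j} {k} i≢0 eq = ℤ.neg-injective (trans (sym (ℤ.-1*i≡-i _)) (trans (sym (sgn-* -[1+ m ] j))
  (trans eq (trans (sgn-* -[1+ m ] k) (ℤ.-1*i≡-i _)))))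

sgn≡0 : ∀ {i} → sgn i ≡ 0ℤ → i ≡ 0ℤ
sgn≡0 {+ 0}    _  = refl

-- Membership in ℕ can be read off a sign: a coordinate computed in ℤ returns to ℕ by comparison
-- with the sign of a natural number.
sgn≡sgn-+ : ∀ {k} i → sgn (+ k) ≡ sgn i → ∃ λ m → i ≡ + m
sgn≡sgn-+ (+ m) eq = m , refl
sgn≡sgn-+ {zero}  -[1+ m ] ()
sgn≡sgn-+ {suc k} -[1+ m ] ()

+∣i∣≡sgn*i : ∀ i → + ∣ i ∣ ≡ sgn i ℤ.* i
+∣i∣≡sgn*i (+ 0)    = refl
+∣i∣≡sgn*i +[1+ m ] = sym (ℤ.*-identityˡ _)
+∣i∣≡sgn*i -[1+ m ] = sym (ℤ.-1*i≡-i -[1+ m ])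

sgn-⊖-> : ∀ {m n} → n < m → sgn (m ℤ.⊖ n) ≡ 1ℤ
sgn-⊖-> {suc m} {zero}  _ = refl
sgn-⊖-> {suc m} {suc n} (s≤s n<m) = trans (cong sgn (ℤ.[1+m]⊖[1+n]≡m⊖n m n)) (sgn-⊖-> n<m)

-- Used in the contrapositive: a step `j` that changes the sign is at least as large as `i`, so the
-- value before the step was small.
sgn-+-near : ∀ i j → ∣ j ∣ < ∣ i ∣ → sgn (i ℤ.+ j) ≡ sgn i
sgn-+-near +[1+ m ] (+ n)    _ = refl
sgn-+-near +[1+ m ] -[1+ n ] (s≤s n<m) = trans (cong sgn (ℤ.[1+m]⊖[1+n]≡m⊖n m n)) (sgn-⊖-> n<m)
sgn-+-near -[1+ m ] (+ n)    n<m = trans (cong sgn (ℤ.⊖-swap n (suc m)))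
  (trans (sgn-neg (suc m ℤ.⊖ n)) (cong ℤ.-_ (sgn-⊖-> n<m)))
sgn-+-near -[1+ m ] -[1+ n ] _ = refl

sgn-difference : ∀ {m n} → m < n → sgn (+ n ℤ.- + m) ≡ 1ℤ
sgn-difference {m} {n} m<n = trans (cong sgn (ℤ.[+m]-[+n]≡m⊖n n m)) (sgn-⊖-> m<n)

sgn-difference⁻¹ : ∀ {m n} → sgn (+ n ℤ.- + m) ≡ 1ℤ → m < n
sgn-difference⁻¹ {m} {n} eq with ℕ.≤-total n m
... | inj₂ m≤n = ℕ.≤∧≢⇒< m≤n λ { refl → contradiction (trans (sym eq) (cong sgn (ℤ.+-inverseʳ (+ n)))) λ () }
... | inj₁ n≤m with ℕ.m≤n⇒m<n∨m≡n n≤m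
... | inj₂ refl = contradiction (trans (sym eq) (cong sgn (ℤ.+-inverseʳ (+ n)))) λ ()
... | inj₁ n<m = contradiction (trans (sym eq) (trans (cong sgn (negate (+ n) (+ m)))
                   (trans (sgn-neg (+ m ℤ.- + n)) (cong ℤ.-_ (sgn-difference n<m))))) λ ()
  where
  negate : ∀ i j → i ℤ.- j ≡ ℤ.- (j ℤ.- i)
  negate = solve-∀

-- Integer affine forms on ℕⁿ

lin : ∀ {n} → Vec ℤ n → Vec ℕ n → ℤ
lin []      []      = 0ℤ
lin (a ∷ u) (x ∷ v) = a ℤ.* + x ℤ.+ lin u v

combine : ∀ {n} → ℤ → Vec ℤ n → ℤ → Vec ℤ n → Vec ℤ n
combine α u β v = zipWith (λ a b → α ℤ.* a ℤ.+ β ℤ.* b) u v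

lin-combine : ∀ {n} α (u : Vec ℤ n) β v x → lin (combine α u β v) x ≡ α ℤ.* lin u x ℤ.+ β ℤ.* lin v x
lin-combine α []      β []      []      = sym (trans (cong₂ ℤ._+_ (ℤ.*-zeroʳ α) (ℤ.*-zeroʳ β)) refl)
lin-combine α (a ∷ u) β (b ∷ v) (k ∷ x) rewrite lin-combine α u β v x = rearrange α β a b (+ k) (lin u x) (lin v x)
  where
  rearrange : ∀ α β a b k s t → (α ℤ.* a ℤ.+ β ℤ.* b) ℤ.* k ℤ.+ (α ℤ.* s ℤ.+ β ℤ.* t)
                              ≡ α ℤ.* (a ℤ.* k ℤ.+ s) ℤ.+ β ℤ.* (b ℤ.* k ℤ.+ t)
  rearrange = solve-∀

zeros : ∀ {n} → Vec ℤ n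
zeros = replicate _ 0ℤ

lin-zeros : ∀ {n} (x : Vec ℕ n) → lin zeros x ≡ 0ℤ
lin-zeros []      = refl
lin-zeros (k ∷ x) rewrite lin-zeros x = refl

unit : ∀ {n} → Fin n → Vec ℤ n
unit zero    = 1ℤ ∷ zeros
unit (suc i) = 0ℤ ∷ unit i

lin-unit : ∀ {n} (i : Fin n) x → lin (unit i) x ≡ + lookup x i
lin-unit zero    (k ∷ x) rewrite lin-zeros x = trans (ℤ.+-identityʳ _) (ℤ.*-identityˡ _)
lin-unit (suc i) (k ∷ x) = trans (ℤ.+-identityˡ _) (lin-unit i x)

record Form (n : ℕ) : Set where
  constructor form
  field
    coefs    : Vec ℤ n
    constant : ℤ

open Form public

⟪_⟫ : ∀ {n} → Form n → Vec ℕ n → ℤ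
⟪ ℓ ⟫ x = lin (coefs ℓ) x ℤ.+ constant ℓ

lead : ∀ {n} → Form (suc n) → ℤ
lead = Vec.head ∘ coefs

rest : ∀ {n} → Form (suc n) → Form n
rest ℓ = form (Vec.tail (coefs ℓ)) (constant ℓ)

⟪⟫-∷ : ∀ {n} (ℓ : Form (suc n)) z y → ⟪ ℓ ⟫ (z ∷ y) ≡ lead ℓ ℤ.* + z ℤ.+ ⟪ rest ℓ ⟫ y
⟪⟫-∷ (form (a ∷ u) e) z y = ℤ.+-assoc (a ℤ.* + z) (lin u y) e

-- Congruence, similarity and good sets

infix 4 _≡_mod_
-- The integer quotients are kept as data: `lin-mod` assembles them into the quotient from which
-- `extend` computes its new coordinate.
record _≡_mod_ {n} (x y : Vec ℕ n) (M : ℕ) : Set where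
  constructor residues
  field
    pointwise : Pointwise (λ a b → ∃ λ q → + b ≡ + a ℤ.+ + M ℤ.* q) x y

open _≡_mod_ public

mod-∷ : ∀ {n M a b} {x y : Vec ℕ n} → (∃ λ q → + b ≡ + a ℤ.+ + M ℤ.* q) → x ≡ y mod M → a ∷ x ≡ b ∷ y mod M
mod-∷ q eq = residues (q ∷ pointwise eq)

mod-refl : ∀ {n M} {x : Vec ℕ n} → x ≡ x mod M
mod-refl {M = M} = residues (Pointwise.refl λ {a} → 0ℤ ,
  sym (trans (cong (ℤ._+_ (+ a)) (ℤ.*-zeroʳ (+ M))) (ℤ.+-identityʳ (+ a))))

mod-sym : ∀ {n M} {x y : Vec ℕ n} → x ≡ y mod M → y ≡ x mod M
mod-sym {M = M} (residues eqs) = residues (Pointwise.sym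
  (λ { {a} (q , eq) → ℤ.- q , trans (rearrange (+ a) (+ M) q) (cong (ℤ._+ + M ℤ.* (ℤ.- q)) (sym eq)) }) eqs)
  where
  rearrange : ∀ a m q → a ≡ (a ℤ.+ m ℤ.* q) ℤ.+ m ℤ.* (ℤ.- q)
  rearrange = solve-∀

mod-trans : ∀ {n M} {x y z : Vec ℕ n} → x ≡ y mod M → y ≡ z mod M → x ≡ z mod M
mod-trans {M = M} (residues eqs) (residues eqs′) = residues (Pointwise.trans
  (λ { {a} (q , eq) (q′ , eq′) → q ℤ.+ q′ , trans eq′ (trans (cong (ℤ._+ + M ℤ.* q′) eq) (rearrange (+ a) (+ M) q q′)) })
  eqs eqs′)
  where
  rearrange : ∀ a m q q′ → (a ℤ.+ m ℤ.* q) ℤ.+ m ℤ.* q′ ≡ a ℤ.+ m ℤ.* (q ℤ.+ q′)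
  rearrange = solve-∀

mod-∣ : ∀ {n M M′} {x y : Vec ℕ n} → M ∣ M′ → x ≡ y mod M′ → x ≡ y mod M
mod-∣ {M = M} (divides c refl) (residues eqs) = residues (Pointwise.map
  (λ { {a} (q , eq) → + c ℤ.* q , trans eq (cong (ℤ._+_ (+ a))
         (trans (cong (ℤ._* q) (ℤ.pos-* c M)) (rearrange (+ c) (+ M) q))) })
  eqs)
  where
  rearrange : ∀ c m q → (c ℤ.* m) ℤ.* q ≡ m ℤ.* (c ℤ.* q)
  rearrange = solve-∀

lin-mod : ∀ {n M} (u : Vec ℤ n) {x y} → x ≡ y mod M → ∃ λ q → lin u y ≡ lin u x ℤ.+ + M ℤ.* q
lin-mod {M = M} []      (residues [])  = 0ℤ , sym (trans (ℤ.+-identityˡ _) (ℤ.*-zeroʳ (+ M)))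
lin-mod {M = M} (c ∷ u) {a ∷ x} {b ∷ y} (residues ((q , eq) ∷ eqs)) with lin-mod {M = M} u (residues eqs)
... | q′ , eq′ = c ℤ.* q ℤ.+ q′ , trans (cong₂ (λ s t → c ℤ.* s ℤ.+ t) eq eq′) (rearrange c (+ a) (+ M) q (lin u x) q′)
  where
  rearrange : ∀ c a m q s q′ → c ℤ.* (a ℤ.+ m ℤ.* q) ℤ.+ (s ℤ.+ m ℤ.* q′)
                             ≡ (c ℤ.* a ℤ.+ s) ℤ.+ m ℤ.* (c ℤ.* q ℤ.+ q′)
  rearrange = solve-∀

record Similar {n} (M : ℕ) (L : List (Form n)) (x y : Vec ℕ n) : Set where
  field
    congruent : x ≡ y mod M
    sameSigns : ∀ {ℓ} → ℓ ∈ L → sgn (⟪ ℓ ⟫ x) ≡ sgn (⟪ ℓ ⟫ y)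

open Similar public

module _ {n M : ℕ} {L : List (Form n)} where

  similar-refl : ∀ {x} → Similar M L x x
  similar-refl = record { congruent = mod-refl ; sameSigns = λ _ → refl }

  similar-sym : ∀ {x y} → Similar M L x y → Similar M L y x
  similar-sym s = record { congruent = mod-sym (congruent s) ; sameSigns = sym ∘ sameSigns s }

  similar-trans : ∀ {x y z} → Similar M L x y → Similar M L y z → Similar M L x z
  similar-trans s t = record { congruent = mod-trans (congruent s) (congruent t)
                             ; sameSigns = λ ℓ∈L → trans (sameSigns s ℓ∈L) (sameSigns t ℓ∈L) }

-- A semantic substitute for definability by a quantifier-free formula.
record Good {n} (P : Vec ℕ n → Set) : Set where
  field
    modulus   : ℕ
    modulus≢0 : NonZero modulus
    forms     : List (Form n)
    transfer  : ∀ {x y} → Similar modulus forms x y → P x → P y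

good-map : ∀ {n} {P Q : Vec ℕ n → Set} → (∀ x → P x → Q x) → (∀ x → Q x → P x) → Good P → Good Q
good-map f g p = record { Good p ; transfer = λ s → f _ ∘ Good.transfer p s ∘ g _ }

good-¬ : ∀ {n} {P : Vec ℕ n → Set} → Good P → Good (¬_ ∘ P)
good-¬ p = record { Good p ; transfer = λ s ¬p → ¬p ∘ Good.transfer p (similar-sym s) }

module _ {n} {P Q : Vec ℕ n → Set} (p : Good P) (q : Good Q) where
  private
    module P = Good p
    module Q = Good q

    similarˡ : ∀ {x y} → Similar (P.modulus * Q.modulus) (P.forms List.++ Q.forms) x y → Similar P.modulus P.forms x y
    similarˡ s = record { congruent = mod-∣ (m∣m*n _) (congruent s) ; sameSigns = sameSigns s ∘ ∈-++⁺ˡ }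

    similarʳ : ∀ {x y} → Similar (P.modulus * Q.modulus) (P.forms List.++ Q.forms) x y → Similar Q.modulus Q.forms x y
    similarʳ s = record { congruent = mod-∣ (n∣m*n P.modulus) (congruent s) ; sameSigns = sameSigns s ∘ ∈-++⁺ʳ P.forms }

  good-× : Good (λ x → P x × Q x)
  good-× = record
    { modulus≢0 = ℕ.m*n≢0 _ _ {{P.modulus≢0}} {{Q.modulus≢0}}
    ; transfer  = λ s (p , q) → P.transfer (similarˡ s) p , Q.transfer (similarʳ s) q }

  good-⊎ : Good (λ x → P x ⊎ Q x)
  good-⊎ = record
    { modulus≢0 = ℕ.m*n≢0 _ _ {{P.modulus≢0}} {{Q.modulus≢0}}
    ; transfer  = λ s → Sum.map (P.transfer (similarˡ s)) (Q.transfer (similarʳ s)) }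

good-→ : ∀ {n} {P Q : Vec ℕ n → Set} → (∀ x → Dec (P x)) → Good P → Good Q → Good (λ x → P x → Q x)
good-→ P? p q = good-map
  (λ x → λ { (inj₁ ¬p) p → contradiction p ¬p ; (inj₂ q) _ → q })
  (λ x f → decide f (P? x))
  (good-⊎ (good-¬ p) q)
  where
  decide : ∀ {P Q : Set} → (P → Q) → Dec P → ¬ P ⊎ Q
  decide f (yes p) = inj₂ (f p)
  decide f (no ¬p) = inj₁ ¬p

good-sgn : ∀ {n} (ℓ : Form n) (S : ℤ → Set) → Good (λ x → S (sgn (⟪ ℓ ⟫ x)))
good-sgn ℓ S = record { modulus = 1 ; modulus≢0 = _ ; forms = ℓ ∷ []
                      ; transfer = λ s → subst S (sameSigns s (here refl)) }

good-⊤ : ∀ {n} → Good {n} (λ _ → ⊤)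
good-⊤ = record { modulus = 1 ; modulus≢0 = _ ; forms = [] ; transfer = λ _ _ → tt }

-- The value 0 is replaced by 1 so that products of factors stay nonzero; a nonzero `k` still
-- divides its factor.
factor : ℕ → ℕ
factor zero    = 1
factor (suc k) = suc k

factor≢0 : ∀ k → NonZero (factor k)
factor≢0 zero    = _
factor≢0 (suc k) = _

∣-factor : ∀ {k} → k ≢ 0 → k ∣ factor k
∣-factor {zero}  k≢0 = contradiction refl k≢0
∣-factor {suc k} _   = ∣-refl

-- Projections of good sets

module Elimination {n} (M : ℕ) (L : List (Form (suc n))) where

  -- The coordinate `z` itself is treated as one more form. It is small when `z` is small, which
  -- ends the descent, and its sign keeps the new coordinate in ℕ.
  head-form : Form (suc n)
  head-form = form (1ℤ ∷ zeros) 0ℤ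

  L⁺ : List (Form (suc n))
  L⁺ = head-form ∷ L

  -- The head is an integer here, because the new coordinate in `extend` enters the forms before it
  -- is known to be non-negative.
  value-at : Form (suc n) → ℤ → Vec ℕ n → ℤ
  value-at ℓ z y = lead ℓ ℤ.* z ℤ.+ ⟪ rest ℓ ⟫ y

  value-at-head : ∀ z y → value-at head-form z y ≡ z
  value-at-head z y rewrite lin-zeros y = trans (ℤ.+-identityʳ _) (ℤ.*-identityˡ z)

  -- lead ℓ · ℓ′ with the head variable eliminated through ℓ = r.
  eliminate : Form (suc n) → ℤ → Form (suc n) → Form n
  eliminate ℓ r ℓ′ = form
    (combine (lead ℓ) (coefs (rest ℓ′)) (ℤ.- lead ℓ′) (coefs (rest ℓ)))
    (lead ℓ ℤ.* constant ℓ′ ℤ.+ lead ℓ′ ℤ.* (r ℤ.- constant ℓ))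

  ⟪eliminate⟫ : ∀ ℓ ℓ′ z y → ⟪ eliminate ℓ (value-at ℓ z y) ℓ′ ⟫ y ≡ lead ℓ ℤ.* value-at ℓ′ z y
  ⟪eliminate⟫ (form (a ∷ u) e) (form (a′ ∷ u′) e′) z y =
    trans (cong (ℤ._+ _) (lin-combine a u′ (ℤ.- a′) u y)) (rearrange a a′ (lin u y) (lin u′ y) e e′ z)
    where
    rearrange : ∀ a a′ s s′ e e′ z →
      (a ℤ.* s′ ℤ.+ (ℤ.- a′) ℤ.* s) ℤ.+ (a ℤ.* e′ ℤ.+ a′ ℤ.* ((a ℤ.* z ℤ.+ (s ℤ.+ e)) ℤ.- e))
      ≡ a ℤ.* (a′ ℤ.* z ℤ.+ (s′ ℤ.+ e′))
    rearrange = solve-∀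

  interval : ℕ → List ℤ
  interval B = List.map +_ (upTo (suc B)) List.++ List.map (λ k → ℤ.- + k) (upTo (suc B))

  ∈-interval : ∀ {B} r → ∣ r ∣ ≤ B → r ∈ interval B
  ∈-interval (+ k)    k≤B = ∈-++⁺ˡ (∈-map⁺ +_ (∈-upTo⁺ (s≤s k≤B)))
  ∈-interval {B} -[1+ k ] k<B = ∈-++⁺ʳ (List.map +_ (upTo (suc B))) (∈-map⁺ (λ k → ℤ.- + k) (∈-upTo⁺ (s≤s k<B)))

  factors : List ℕ
  factors = List.map (factor ∘ ∣_∣ ∘ lead) L⁺

  -- If two tails agree modulo `∣ a ∣ * M`, the tail part of a form with leading coefficient `a`
  -- changes by a multiple of `a * M`, and moving the head by a multiple of `M` can undo this.
  M′ : ℕ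
  M′ = M * product factors

  -- Every form is prepared to be the anchor, with every value `r` that `near` allows; the forms are
  -- then rewritten through the tail alone.
  L′ : List (Form n)
  L′ = concatMap (λ ℓ → concatMap (λ r → List.map (eliminate ℓ r) L⁺) (interval (∣ lead ℓ ∣ * M))) L⁺

  M′≢0 : NonZero M → NonZero M′
  M′≢0 M≢0 = ℕ.m*n≢0 M _ {{M≢0}} {{product≢0 (List-All.map⁺ (List-All.universal (factor≢0 ∘ ∣_∣ ∘ lead) L⁺))}}

  ∣M′ : ∀ {ℓ} → ℓ ∈ L⁺ → lead ℓ ≢ 0ℤ → ∣ lead ℓ ∣ * M ∣ M′
  ∣M′ {ℓ} ℓ∈ a≢0 = subst (_∣ M′) (ℕ.*-comm M ∣ lead ℓ ∣)
    (*-monoʳ-∣ M (∣-trans (∣-factor (a≢0 ∘ ℤ.∣i∣≡0⇒i≡0)) (∈⇒∣product (∈-map⁺ _ ℓ∈))))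

  ∈L′ : ∀ {ℓ r ℓ′} → ℓ ∈ L⁺ → ∣ r ∣ ≤ ∣ lead ℓ ∣ * M → ℓ′ ∈ L⁺ → eliminate ℓ r ℓ′ ∈ L′
  ∈L′ {ℓ} {r} ℓ∈ r≤ ℓ′∈ =
    ∈-concatMap⁺ (λ ℓ → concatMap (λ r → List.map (eliminate ℓ r) L⁺) (interval (∣ lead ℓ ∣ * M)))
      (lose ℓ∈ (∈-concatMap⁺ (λ r → List.map (eliminate ℓ r) L⁺)
        (lose (∈-interval r r≤) (∈-map⁺ (eliminate ℓ r) ℓ′∈))))

  -- Descending z in steps of M without a change of sign ends next to a zero of some form.
  record Anchored (z : ℕ) (y : Vec ℕ n) : Set where
    field
      z₀      : ℕ
      similar : Similar M L (z ∷ y) (z₀ ∷ y)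
      ℓ       : Form (suc n)
      ℓ∈L⁺    : ℓ ∈ L⁺
      lead≢0  : lead ℓ ≢ 0ℤ
      near    : ∣ value-at ℓ (+ z₀) y ∣ ≤ ∣ lead ℓ ∣ * M

  module _ (M≢0 : NonZero M) (em : ExcludedMiddle 0ℓ) where

    value-descend : ∀ (ℓ : Form (suc n)) d y → ⟪ ℓ ⟫ (d ∷ y) ≡ ⟪ ℓ ⟫ (M + d ∷ y) ℤ.+ ℤ.- (lead ℓ ℤ.* + M)
    value-descend ℓ d y = trans (⟪⟫-∷ ℓ d y) (trans (rearrange (lead ℓ) (+ M) (+ d) (⟪ rest ℓ ⟫ y))
      (cong (ℤ._+ ℤ.- (lead ℓ ℤ.* + M)) (sym (⟪⟫-∷ ℓ (M + d) y))))
      where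
      rearrange : ∀ a m d t → a ℤ.* d ℤ.+ t ≡ (a ℤ.* (m ℤ.+ d) ℤ.+ t) ℤ.+ ℤ.- (a ℤ.* m)
      rearrange = solve-∀

    -- For `z ≤ M` the anchor is `head-form`. Otherwise excluded middle asks whether the step from
    -- `M + d` to `d` changes the sign of some form. If not, the descent continues; `M` is positive,
    -- so the fuel suffices. If so, the value of that form is at most the step `∣ lead ℓ ∣ * M`, and
    -- its lead is nonzero, since otherwise the step would not affect it.
    anchor : ∀ fuel z y → z ≤ fuel → Anchored z y
    anchor fuel z y z≤fuel with z ℕ.≤? M
    ... | yes z≤M = record
      { similar = similar-refl ; ℓ = head-form ; ℓ∈L⁺ = here refl ; lead≢0 = λ ()
      ; near = subst (_≤ 1 * M) (sym (cong ∣_∣ (value-at-head (+ z) y))) (ℕ.≤-trans z≤M (ℕ.m≤m+n M 0)) }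
    anchor zero z y z≤0 | no z≰M = contradiction (ℕ.≤-trans z≤0 z≤n) z≰M
    anchor (suc fuel) z y z≤fuel | no z≰M with ℕ.m≤n⇒∃[o]m+o≡n (ℕ.<⇒≤ (ℕ.≰⇒> z≰M))
    ... | d , refl with em {∃ λ ℓ → ℓ ∈ L × sgn (⟪ ℓ ⟫ (M + d ∷ y)) ≢ sgn (⟪ ℓ ⟫ (d ∷ y))}
    ... | no ¬changed = record
      { Anchored below
      ; similar = similar-trans
          (record { congruent = mod-∷ (-1ℤ , rearrange (+ M) (+ d)) mod-refl
                  ; sameSigns = λ ℓ∈L → decidable-stable em λ ne → ¬changed (_ , ℓ∈L , ne) })
          (Anchored.similar below) }
      where
      below = anchor fuel d y (s≤s⁻¹ (ℕ.≤-trans (ℕ.+-monoˡ-≤ d (>-nonZero⁻¹ M {{M≢0}})) z≤fuel))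
      rearrange : ∀ m d → d ≡ m ℤ.+ d ℤ.+ m ℤ.* -1ℤ
      rearrange = solve-∀
    ... | yes (ℓ , ℓ∈L , changed) = record
      { similar = similar-refl ; ℓ = ℓ ; ℓ∈L⁺ = there ℓ∈L
      ; lead≢0 = λ a≡0 → changed (cong sgn (sym (trans (value-descend ℓ d y)
          (trans (cong (λ a → ⟪ ℓ ⟫ (M + d ∷ y) ℤ.+ ℤ.- (a ℤ.* + M)) a≡0) (ℤ.+-identityʳ _)))))
      ; near = ℕ.≮⇒≥ λ far → changed (sym (trans (cong sgn (value-descend ℓ d y))
          (sgn-+-near (⟪ ℓ ⟫ (M + d ∷ y)) (ℤ.- (lead ℓ ℤ.* + M))
            (subst₂ _<_
              (sym (trans (ℤ.∣-i∣≡∣i∣ (lead ℓ ℤ.* + M)) (ℤ.∣i*j∣≡∣i∣*∣j∣ (lead ℓ) (+ M))))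
              (cong ∣_∣ (sym (⟪⟫-∷ ℓ (M + d) y)))
              far)))) }

    -- Between `y` and `y′` the tail part of the anchor changes by a multiple of `∣ a ∣ * M`, and
    -- the head is moved by a multiple of `M` so that the anchor keeps its value. With that value
    -- fixed, `a` times any form is a form in the tail that belongs to `L′`, so its sign is
    -- preserved, and `a` can be cancelled.
    extend : ∀ {y y′} → Similar M′ L′ y y′ → ∀ z → ∃ λ z′ → Similar M L (z ∷ y) (z′ ∷ y′)
    extend {y} {y′} s z = proj₁ nonnegative , similar-trans similar (record
      { congruent = mod-∷ (ℤ.- q , trans (sym (proj₂ nonnegative)) (cong (ℤ._+_ (+ z₀)) (ℤ.neg-distribʳ-* (+ M) q)))
                    (mod-∣ (m∣m*n (product factors)) (congruent s))
      ; sameSigns = λ {ℓ′} ℓ′∈L → trans (cong sgn (⟪⟫-∷ ℓ′ z₀ y)) (trans (signs ℓ′ (there ℓ′∈L))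
          (cong sgn (trans (cong (λ Z → value-at ℓ′ Z y′) (proj₂ nonnegative)) (sym (⟪⟫-∷ ℓ′ _ y′))))) })
      where
      open Anchored (anchor z z y ℕ.≤-refl)
      a = lead ℓ

      divisible = lin-mod (coefs (rest ℓ)) (mod-∣ (∣M′ ℓ∈L⁺ lead≢0) (congruent s))

      -- With `d = proj₁ divisible`, the tail grows by `∣ a ∣ * M * d`, which is
      -- `sgn a * a * M * d`; lowering the head by `M * (sgn a * d)` compensates for it.
      q : ℤ
      q = sgn a ℤ.* proj₁ divisible

      z′ : ℤ
      z′ = + z₀ ℤ.- + M ℤ.* q

      same-value : value-at ℓ z′ y′ ≡ value-at ℓ (+ z₀) y
      same-value = trans
        (cong (λ t → a ℤ.* z′ ℤ.+ (t ℤ.+ constant ℓ)) (trans (proj₂ divisible)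
          (cong (λ i → t ℤ.+ i ℤ.* proj₁ divisible)
            (trans (ℤ.pos-* ∣ a ∣ M) (cong (ℤ._* + M) (+∣i∣≡sgn*i a))))))
        (rearrange a (+ z₀) (+ M) (sgn a) (proj₁ divisible) t (constant ℓ))
        where
        t = lin (coefs (rest ℓ)) y
        rearrange : ∀ a z m s d t e →
          a ℤ.* (z ℤ.- m ℤ.* (s ℤ.* d)) ℤ.+ ((t ℤ.+ s ℤ.* a ℤ.* m ℤ.* d) ℤ.+ e) ≡ a ℤ.* z ℤ.+ (t ℤ.+ e)
        rearrange = solve-∀

      signs : ∀ ℓ′ → ℓ′ ∈ L⁺ → sgn (value-at ℓ′ (+ z₀) y) ≡ sgn (value-at ℓ′ z′ y′)
      signs ℓ′ ℓ′∈ = sgn-*-cancel a lead≢0 (trans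
        (cong sgn (sym (⟪eliminate⟫ ℓ ℓ′ (+ z₀) y)))
        (trans (sameSigns s (∈L′ {r = value-at ℓ (+ z₀) y} ℓ∈L⁺ near ℓ′∈))
          (cong sgn (trans (cong (λ r → ⟪ eliminate ℓ r ℓ′ ⟫ y′) (sym same-value)) (⟪eliminate⟫ ℓ ℓ′ z′ y′)))))

      -- `head-form` belongs to `L⁺`, so `z′` has the same sign as the natural number `z₀`.
      nonnegative : ∃ λ m → z′ ≡ + m
      nonnegative = sgn≡sgn-+ z′ (trans (cong sgn (sym (value-at-head (+ z₀) y)))
        (trans (signs head-form (here refl)) (cong sgn (value-at-head z′ y′))))

-- Definable sets are good

module _ (em : ExcludedMiddle 0ℓ) where

  good-∃ : ∀ {n} {P : Vec ℕ (suc n) → Set} → Good P → Good (λ x → ∃ λ z → P (z ∷ x))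
  good-∃ p = record
    { modulus≢0 = E.M′≢0 P.modulus≢0
    ; transfer  = λ s (z , pz) → let (z′ , s′) = E.extend P.modulus≢0 em s z in z′ , P.transfer s′ pz }
    where
    module P = Good p
    module E = Elimination P.modulus P.forms

  good-∀ : ∀ {n} {P : Vec ℕ (suc n) → Set} → Good P → Good (λ x → ∀ z → P (z ∷ x))
  good-∀ p = good-map (λ x f z → decidable-stable em λ ¬p → f (z , ¬p)) (λ x f (z , ¬p) → ¬p (f z))
    (good-¬ (good-∃ (good-¬ p)))

  good-∀* : ∀ k {n} {P : Vec ℕ (k + n) → Set} → Good P → Good (λ x → ∀ (c : Vec ℕ k) → P (c Vec.++ x))
  good-∀* zero    p = good-map (λ { x q [] → q }) (λ x f → f []) p
  good-∀* (suc k) p = good-map (λ { x f (z ∷ c) → f c z }) (λ x f c z → f (z ∷ c)) (good-∀* k (good-∀ p))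

  term-coefs : ∀ {n} → Term n → Vec ℤ n
  term-coefs (var i) = unit i
  term-coefs (s ⊕ t) = combine 1ℤ (term-coefs s) 1ℤ (term-coefs t)

  lin-term : ∀ {n} (t : Term n) x → lin (term-coefs t) x ≡ + eval x t
  lin-term (var i) x = lin-unit i x
  lin-term (s ⊕ t) x = trans (lin-combine 1ℤ (term-coefs s) 1ℤ (term-coefs t) x)
    (cong₂ ℤ._+_ (trans (ℤ.*-identityˡ _) (lin-term s x)) (trans (ℤ.*-identityˡ _) (lin-term t x)))

  good-⊨ : ∀ {n} (φ : Formula n) → Good (_⊨ φ)
  good-⊨ (s ≐ t) = good-map
    (λ x eq → ℤ.+-injective (ℤ.i-j≡0⇒i≡j _ _ (sgn≡0 (trans (cong sgn (sym (difference-value x))) eq))))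
    (λ x eq → cong sgn (trans (difference-value x) (ℤ.i≡j⇒i-j≡0 (cong +_ eq))))
    (good-sgn (form (combine 1ℤ (term-coefs s) -1ℤ (term-coefs t)) 0ℤ) (_≡ 0ℤ))
    where
    difference-value : ∀ x → lin (combine 1ℤ (term-coefs s) -1ℤ (term-coefs t)) x ℤ.+ 0ℤ ≡ + eval x s ℤ.- + eval x t
    difference-value x = trans (ℤ.+-identityʳ _) (trans (lin-combine 1ℤ (term-coefs s) -1ℤ (term-coefs t) x)
      (cong₂ ℤ._+_ (trans (ℤ.*-identityˡ _) (lin-term s x)) (trans (ℤ.-1*i≡-i _) (cong ℤ.-_ (lin-term t x)))))
  good-⊨ (¬′ φ)   = good-¬ (good-⊨ φ)
  good-⊨ (φ ∧′ ψ) = good-× (good-⊨ φ) (good-⊨ ψ)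
  good-⊨ (φ ∨′ ψ) = good-⊎ (good-⊨ φ) (good-⊨ ψ)
  good-⊨ (∃′ φ)   = good-∃ (good-⊨ φ)
  good-⊨ (∀′ φ)   = good-∀ (good-⊨ φ)

-- Renaming of variables

infixl 9 _‼_
_‼_ : ∀ {n k} → Vec ℕ n → Vec (Fin n) k → Vec ℕ k
x ‼ σ = map (lookup x) σ

pullback : ∀ {n k} → Vec (Fin n) k → Vec ℤ k → Vec ℤ n
pullback []      []      = zeros
pullback (i ∷ σ) (a ∷ u) = combine a (unit i) 1ℤ (pullback σ u)

lin-pullback : ∀ {n k} (σ : Vec (Fin n) k) u x → lin (pullback σ u) x ≡ lin u (x ‼ σ)
lin-pullback []      []      x = lin-zeros x
lin-pullback (i ∷ σ) (a ∷ u) x = trans (lin-combine a (unit i) 1ℤ (pullback σ u) x)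
  (cong₂ (λ s t → a ℤ.* s ℤ.+ t) (lin-unit i x) (trans (ℤ.*-identityˡ _) (lin-pullback σ u x)))

good-rename : ∀ {n k} {P : Vec ℕ k → Set} (σ : Vec (Fin n) k) → Good P → Good (λ x → P (x ‼ σ))
good-rename {P = P} σ p = record
  { P ; forms = List.map (λ ℓ → form (pullback σ (coefs ℓ)) (constant ℓ)) P.forms
  ; transfer = λ {x} {y} s → P.transfer (record
      { congruent = rename-mod σ (congruent s)
      ; sameSigns = λ {ℓ} ℓ∈ → trans (cong (λ t → sgn (t ℤ.+ constant ℓ)) (sym (lin-pullback σ (coefs ℓ) x)))
          (trans (sameSigns s (∈-map⁺ _ ℓ∈)) (cong (λ t → sgn (t ℤ.+ constant ℓ)) (lin-pullback σ (coefs ℓ) y))) }) }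
  where
  module P = Good p
  rename-mod : ∀ {n k M} {x y : Vec ℕ n} (σ : Vec (Fin n) k) → x ≡ y mod M → x ‼ σ ≡ y ‼ σ mod M
  rename-mod []      eq = residues []
  rename-mod (i ∷ σ) eq = mod-∷ (Pointwise.lookup (pointwise eq) i) ( rename-mod σ eq)

good-< : ∀ {n} (i j : Fin n) → Good (λ x → lookup x i < lookup x j)
good-< i j = good-map
  (λ x eq → sgn-difference⁻¹ (trans (cong sgn (sym (difference-value x))) eq))
  (λ x i<j → trans (cong sgn (difference-value x)) (sgn-difference i<j))
  (good-sgn (form (combine 1ℤ (unit j) -1ℤ (unit i)) 0ℤ) (_≡ 1ℤ))
  where
  difference-value : ∀ x → lin (combine 1ℤ (unit j) -1ℤ (unit i)) x ℤ.+ 0ℤ ≡ + lookup x j ℤ.- + lookup x i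
  difference-value x = trans (ℤ.+-identityʳ _) (trans (lin-combine 1ℤ (unit j) -1ℤ (unit i) x)
    (cong₂ ℤ._+_ (trans (ℤ.*-identityˡ _) (lin-unit j x)) (trans (ℤ.-1*i≡-i _) (cong ℤ.-_ (lin-unit i x)))))

good-≤ : ∀ {n} (i j : Fin n) → Good (λ x → lookup x i ≤ lookup x j)
good-≤ i j = good-map (λ x → ℕ.≮⇒≥) (λ x → ℕ.≤⇒≯) (good-¬ (good-< j i))

-- Affine pieces

infixl 6 _⊞_
_⊞_ : ∀ {n} → Vec ℕ n → Vec ℕ n → Vec ℕ n
_⊞_ = zipWith _+_

infixl 7 _·_
_·_ : ∀ {n} → ℕ → Vec ℕ n → Vec ℕ n
k · v = map (k *_) v

origin : ∀ {n} → Vec ℕ n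
origin = replicate _ 0

span : ∀ {n d} → Vec (Vec ℕ n) d → Vec ℕ d → Vec ℕ n
span []       []      = origin
span (v ∷ vs) (k ∷ w) = k · v ⊞ span vs w

-- Injectivity of `point` is not part of the record. For the parts of a split of ℕⁿ it follows from
-- the bijection of parameters.
record Piece (n : ℕ) : Set where
  constructor piece
  field
    {dim} : ℕ
    base  : Vec ℕ n
    gens  : Vec (Vec ℕ n) dim

open Piece public

Parameter : ∀ {n} → Piece n → Set
Parameter p = Vec ℕ (dim p)

point : ∀ {n} (p : Piece n) → Parameter p → Vec ℕ n
point p w = base p ⊞ span (gens p) w

⊞-identityʳ : ∀ {n} (v : Vec ℕ n) → v ⊞ origin ≡ v
⊞-identityʳ []      = refl
⊞-identityʳ (x ∷ v) = cong₂ _∷_ (ℕ.+-identityʳ x) (⊞-identityʳ v)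

⊞-identityˡ : ∀ {n} (v : Vec ℕ n) → origin ⊞ v ≡ v
⊞-identityˡ []      = refl
⊞-identityˡ (x ∷ v) = cong (x ∷_) (⊞-identityˡ v)

multiple-origin : ∀ {n} M → M · origin {n} ≡ origin
multiple-origin {zero}  M = refl
multiple-origin {suc n} M = cong₂ _∷_ (ℕ.*-zeroʳ M) (multiple-origin M)

⊞-exchange : ∀ {n} (u v w : Vec ℕ n) → u ⊞ (v ⊞ w) ≡ v ⊞ (u ⊞ w)
⊞-exchange []      []      []      = refl
⊞-exchange (a ∷ u) (b ∷ v) (c ∷ w) = cong₂ _∷_ (identity a b c) (⊞-exchange u v w)
  where
  identity : ∀ a b c → a + (b + c) ≡ b + (a + c)
  identity = ℕ-Solver.solve-∀

lin-⊞ : ∀ {n} (u : Vec ℤ n) v w → lin u (v ⊞ w) ≡ lin u v ℤ.+ lin u w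
lin-⊞ []      []      []      = refl
lin-⊞ (a ∷ u) (x ∷ v) (y ∷ w) rewrite lin-⊞ u v w = identity a (+ x) (+ y) (lin u v) (lin u w)
  where
  identity : ∀ a x y s t → a ℤ.* (x ℤ.+ y) ℤ.+ (s ℤ.+ t) ≡ a ℤ.* x ℤ.+ s ℤ.+ (a ℤ.* y ℤ.+ t)
  identity = solve-∀

lin-· : ∀ {n} (u : Vec ℤ n) k v → lin u (k · v) ≡ + k ℤ.* lin u v
lin-· []      k []      = sym (ℤ.*-zeroʳ (+ k))
lin-· (a ∷ u) k (x ∷ v) = trans (cong₂ (λ s t → a ℤ.* s ℤ.+ t) (ℤ.pos-* k x) (lin-· u k v)) (identity a (+ k) (+ x) (lin u v))
  where
  identity : ∀ a k x s → a ℤ.* (k ℤ.* x) ℤ.+ k ℤ.* s ≡ k ℤ.* (a ℤ.* x ℤ.+ s)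
  identity = solve-∀

lin-origin : ∀ {n} (u : Vec ℤ n) → lin u origin ≡ 0ℤ
lin-origin []      = refl
lin-origin (a ∷ u) rewrite lin-origin u | ℤ.*-zeroʳ a = refl

⟪⟫-⊞ : ∀ {n} (ℓ : Form n) v w → ⟪ ℓ ⟫ (v ⊞ w) ≡ ⟪ ℓ ⟫ v ℤ.+ lin (coefs ℓ) w
⟪⟫-⊞ ℓ v w rewrite lin-⊞ (coefs ℓ) v w = identity (lin (coefs ℓ) v) (lin (coefs ℓ) w) (constant ℓ)
  where
  identity : ∀ s t e → s ℤ.+ t ℤ.+ e ≡ s ℤ.+ e ℤ.+ t
  identity = solve-∀

-- Splitting pieces into homogeneous parts

-- The partition concerns parameters and not points, so splits compose for arbitrary pieces. When ℕⁿ
-- is generated by the unit vectors, parameters and points coincide.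
record Split {n} (p : Piece n) : Set₁ where
  field
    Index         : Set
    finite        : Finite Index
    part          : Index → Piece n
    reindex       : Σ Index (Parameter ∘ part) ↔ Parameter p
    point-reindex : ∀ i w → point p (Inverse.to reindex (i , w)) ≡ point (part i) w

open Split public

whole-split : ∀ {n} (p : Piece n) → Split p
whole-split p = record
  { Index = ⊤ ; finite = Finite-⊤ ; part = λ _ → p
  ; reindex = mk↔ₛ′ proj₂ (tt ,_) (λ _ → refl) (λ _ → refl) ; point-reindex = λ _ _ → refl }

nest : ∀ {n} {p : Piece n} (s : Split p) → (∀ i → Split (part s i)) → Split p
nest s t = record
  { Index   = Σ (Index s) (Index ∘ t)
  ; finite  = Finite-Σ (finite s) (finite ∘ t)
  ; part    = λ (i , j) → part (t i) j
  ; reindex = ↔-sym Σ-assoc-↔ ⨾ Σ-cong₂-↔ (reindex ∘ t) ⨾ reindex s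
  ; point-reindex = λ (i , j) w → trans (point-reindex s i _) (point-reindex (t i) j w) }

Homogeneous : ∀ {n} → (Vec ℕ n → Vec ℕ n → Set) → Piece n → Set
Homogeneous R p = ∀ w w′ → R (point p w) (point p w′)

record Decomposition {n} (R : Vec ℕ n → Vec ℕ n → Set) (p : Piece n) : Set₁ where
  field
    split       : Split p
    homogeneous : ∀ i → Homogeneous R (part split i)

open Decomposition public

module _ {n} {R : Vec ℕ n → Vec ℕ n → Set} where

  leaf : ∀ {p} → Homogeneous R p → Decomposition R p
  leaf h = record { split = whole-split _ ; homogeneous = λ _ → h }

  node : ∀ {p} (s : Split p) → (∀ i → Decomposition R (part s i)) → Decomposition R p
  node s d = record { split = nest s (split ∘ d) ; homogeneous = λ (i , j) → homogeneous (d i) j }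

  decomposition-map : ∀ {S p} → (∀ x y → R x y → S x y) → Decomposition R p → Decomposition S p
  decomposition-map f d = record { split = split d ; homogeneous = λ i w w′ → f _ _ (homogeneous d i w w′) }

Refinable : ∀ {n} → (Vec ℕ n → Vec ℕ n → Set) → Set₁
Refinable R = ∀ p → Decomposition R p

-- Homogeneity for `R` survives the second split, since the points of a subpiece are points of the
-- piece.
refinable-× : ∀ {n} {R S : Vec ℕ n → Vec ℕ n → Set} → Refinable R → Refinable S → Refinable (λ x y → R x y × S x y)
refinable-× {R = R} {S} r s p = record
  { split = nest (split (r p)) (λ i → split (s (part (split (r p)) i)))
  ; homogeneous = λ (i , j) w w′ →
      subst₂ R (point-reindex (split (s _)) j w) (point-reindex (split (s _)) j w′) (homogeneous (r p) i _ _)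
      , homogeneous (s _) j w w′ }

data Select {A : Set} (a : A) : ∀ {d} → Vec A d → Vec A (suc d) → Set where
  here  : ∀ {d} {as : Vec A d} → Select a as (a ∷ as)
  there : ∀ {d b} {as : Vec A d} {bs} → Select a as bs → Select a (b ∷ as) (b ∷ bs)

data Found {A : Set} (P : A → Set) : ∀ {d} → Vec A d → Set where
  found : ∀ {d a} {as : Vec A d} {bs} → Select a as bs → P a → Found P bs

search : ∀ {A : Set} {P Q : A → Set} {d} {as : Vec A d} → All (λ a → P a ⊎ Q a) as → All P as ⊎ Found Q as
search []            = inj₁ []
search (inj₂ q ∷ ps) = inj₂ (found here q)
search (inj₁ p ∷ ps) with search ps
... | inj₁ all         = inj₁ (p ∷ all)
... | inj₂ (found s q) = inj₂ (found (there s) q)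

all-select : ∀ {A : Set} {P : A → Set} {a d} {as : Vec A d} {bs} → Select a as bs → All P bs → P a × All P as
all-select here      (p ∷ ps) = p , ps
all-select (there s) (p ∷ ps) = let (q , qs) = all-select s ps in q , p ∷ qs

module _ {A : Set} {a : A} where

  insert : ∀ {d} {as : Vec A d} {bs} → Select a as bs → ℕ × Vec ℕ d → Vec ℕ (suc d)
  insert here      (k , w)     = k ∷ w
  insert (there s) (k , l ∷ w) = l ∷ insert s (k , w)

  extract : ∀ {d} {as : Vec A d} {bs} → Select a as bs → Vec ℕ (suc d) → ℕ × Vec ℕ d
  extract here      (k ∷ w) = k , w
  extract (there s) (l ∷ w) = let (k , w′) = extract s w in k , l ∷ w′

  insert-extract : ∀ {d} {as : Vec A d} {bs} (s : Select a as bs) w → insert s (extract s w) ≡ w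
  insert-extract here      (k ∷ w) = refl
  insert-extract (there s) (l ∷ w) = cong (l ∷_) (insert-extract s w)

  extract-insert : ∀ {d} {as : Vec A d} {bs} (s : Select a as bs) kw → extract s (insert s kw) ≡ kw
  extract-insert here      (k , w)     = refl
  extract-insert (there s) (k , l ∷ w) = cong (λ (k , w) → k , l ∷ w) (extract-insert s (k , w))

span-insert : ∀ {n d} {v : Vec ℕ n} {vs : Vec _ d} {us} (s : Select v vs us) k w →
              span us (insert s (k , w)) ≡ k · v ⊞ span vs w
span-insert here k w = refl
span-insert {v = v} {u ∷ vs} (there s) k (l ∷ w) =
  trans (cong (l · u ⊞_) (span-insert s k w)) (⊞-exchange (l · u) (k · v) (span vs w))

select-split : ∀ {n d} {b v : Vec ℕ n} {vs : Vec _ d} {us} → Select v vs us → Split (piece b us)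
select-split {b = b} {v} {vs} s = record
  { Index = ⊤ ; finite = Finite-⊤ ; part = λ _ → piece b (v ∷ vs)
  ; reindex = mk↔ₛ′ (λ { (_ , k ∷ w) → insert s (k , w) })
      (λ w → let (k , w′) = extract s w in tt , k ∷ w′)
      (insert-extract s)
      (λ { (_ , k ∷ w) → cong (λ (k , w) → tt , k ∷ w) (extract-insert s (k , w)) })
  ; point-reindex = λ { _ (k ∷ w) → cong (b ⊞_) (span-insert s k w) } }

-- The splits below act on leading generators; a generator found by `search` is brought to the front
-- first.
reorder : ∀ {n d R} {b v : Vec ℕ n} {vs : Vec _ d} {us} → Select v vs us →
          Decomposition R (piece b (v ∷ vs)) → Decomposition R (piece b us)
reorder s d = node (select-split s) (λ _ → d)

Finite-Bool : Finite Bool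
Finite-Bool = 2 , ↔-sym Fin.2↔Bool

-- Either the coefficient of `v` is 0 and `v` disappears, or it is positive and one copy of `v` is
-- absorbed into the base.
zero-split : ∀ {n d} (b v : Vec ℕ n) (vs : Vec _ d) → Split (piece b (v ∷ vs))
zero-split {n} {d} b v vs = record
  { Index = Bool ; finite = Finite-Bool ; part = part′
  ; reindex = mk↔ₛ′ to′
      (λ { (zero ∷ w) → true , w ; (suc k ∷ w) → false , k ∷ w })
      (λ { (zero ∷ w) → refl ; (suc k ∷ w) → refl })
      (λ { (true , w) → refl ; (false , k ∷ w) → refl })
  ; point-reindex = λ { true w → vanish b v (span vs w) ; false (k ∷ w) → shift b v k (span vs w) } }
  where
  part′ : Bool → Piece n
  part′ true  = piece b vs
  part′ false = piece (b ⊞ v) (v ∷ vs)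

  to′ : Σ Bool (Parameter ∘ part′) → Vec ℕ (suc d)
  to′ (true  , w)     = 0 ∷ w
  to′ (false , k ∷ w) = suc k ∷ w

  vanish : ∀ {n} (b v r : Vec ℕ n) → b ⊞ (0 · v ⊞ r) ≡ b ⊞ r
  vanish []      []      []      = refl
  vanish (x ∷ b) (y ∷ v) (z ∷ r) = cong (_ ∷_) (vanish b v r)

  shift : ∀ {n} (b v : Vec ℕ n) k r → b ⊞ (suc k · v ⊞ r) ≡ (b ⊞ v) ⊞ (k · v ⊞ r)
  shift []      []      k []      = refl
  shift (x ∷ b) (y ∷ v) k (z ∷ r) = cong₂ _∷_ (identity x y k z) (shift b v k r)
    where
    identity : ∀ x y k z → x + (suc k * y + z) ≡ (x + y) + (k * y + z)
    identity = ℕ-Solver.solve-∀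

-- k · v ⊞ l · w is (k − l) · v ⊞ l · (v ⊞ w) if k ≥ l, and w ⊞ k · (v ⊞ w) ⊞ (l − k − 1) · w otherwise.
compare-split : ∀ {n d} (b v w : Vec ℕ n) (vs : Vec _ d) → Split (piece b (v ∷ w ∷ vs))
compare-split {n} {d} b v w vs = record
  { Index = Bool ; finite = Finite-Bool ; part = part′
  -- `compare` does not reduce on `k + l` and `l`, so the second inverse law is obtained from
  -- injectivity of `to′`.
  ; reindex = mk↔ₛ′ to′ from′ to-from (λ x → to-injective (from′ (to′ x)) x (to-from (to′ x)))
  ; point-reindex = λ { true (k ∷ l ∷ x) → greater-identity b v w k l (span vs x)
                      ; false (k ∷ l ∷ x) → less-identity b v w k l (span vs x) } }
  where
  part′ : Bool → Piece n
  part′ true  = piece b (v ∷ v ⊞ w ∷ vs)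
  part′ false = piece (b ⊞ w) (v ⊞ w ∷ w ∷ vs)

  to′ : Σ Bool (Parameter ∘ part′) → Vec ℕ (2 + d)
  to′ (true  , k ∷ l ∷ x) = k + l ∷ l ∷ x
  to′ (false , k ∷ l ∷ x) = k ∷ suc (k + l) ∷ x

  from′ : Vec ℕ (2 + d) → Σ Bool (Parameter ∘ part′)
  from′ (k ∷ l ∷ x) with compare k l
  ... | less _ m    = false , k ∷ m ∷ x
  ... | equal _     = true  , 0 ∷ l ∷ x
  ... | greater _ m = true  , suc m ∷ l ∷ x

  to-from : ∀ x → to′ (from′ x) ≡ x
  to-from (k ∷ l ∷ x) with compare k l
  ... | less _ m    = refl
  ... | equal _     = refl
  ... | greater _ m = cong (λ k → suc k ∷ l ∷ x) (ℕ.+-comm m l)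

  absurd : ∀ {k l k′ l′ : ℕ} {x y : Vec ℕ d} → ¬ (_≡_ {A = Vec ℕ (2 + d)} (k + l ∷ l ∷ x) (k′ ∷ suc (k′ + l′) ∷ y))
  absurd {k} {l} {l′ = l′} eq with cong Vec.head eq | cong (Vec.head ∘ Vec.tail) eq
  ... | refl | eq′ = ℕ.<-irrefl eq′ (s≤s (ℕ.≤-trans (ℕ.m≤n+m l k) (ℕ.m≤m+n (k + l) l′)))

  to-injective : ∀ x y → to′ x ≡ to′ y → x ≡ y
  to-injective (true , k ∷ l ∷ x) (true , k′ ∷ l′ ∷ y) eq
    with cong (Vec.head ∘ Vec.tail) eq | cong (Vec.tail ∘ Vec.tail) eq
  ... | refl | refl = cong (λ k → true , k ∷ l ∷ x) (ℕ.+-cancelʳ-≡ l k k′ (cong Vec.head eq))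
  to-injective (false , k ∷ l ∷ x) (false , k′ ∷ l′ ∷ y) eq with cong Vec.head eq | cong (Vec.tail ∘ Vec.tail) eq
  ... | refl | refl = cong (λ l → false , k ∷ l ∷ x)
    (ℕ.+-cancelˡ-≡ k l l′ (ℕ.suc-injective (cong (Vec.head ∘ Vec.tail) eq)))
  to-injective (true , k ∷ l ∷ x) (false , k′ ∷ l′ ∷ y) eq = contradiction eq absurd
  to-injective (false , k ∷ l ∷ x) (true , k′ ∷ l′ ∷ y) eq = contradiction (sym eq) absurd

  greater-identity : ∀ {n} (b v w : Vec ℕ n) k l r →
    b ⊞ ((k + l) · v ⊞ (l · w ⊞ r)) ≡ b ⊞ (k · v ⊞ (l · (v ⊞ w) ⊞ r))
  greater-identity []      []      []      k l []      = refl
  greater-identity (a ∷ b) (x ∷ v) (y ∷ w) k l (z ∷ r) = cong₂ _∷_ (identity a x y k l z) (greater-identity b v w k l r)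
    where
    identity : ∀ a x y k l z → a + ((k + l) * x + (l * y + z)) ≡ a + (k * x + (l * (x + y) + z))
    identity = ℕ-Solver.solve-∀

  less-identity : ∀ {n} (b v w : Vec ℕ n) k l r →
    b ⊞ (k · v ⊞ (suc (k + l) · w ⊞ r)) ≡ (b ⊞ w) ⊞ (k · (v ⊞ w) ⊞ (l · w ⊞ r))
  less-identity []      []      []      k l []      = refl
  less-identity (a ∷ b) (x ∷ v) (y ∷ w) k l (z ∷ r) = cong₂ _∷_ (identity a x y k l z) (less-identity b v w k l r)
    where
    identity : ∀ a x y k l z → a + (k * x + (suc (k + l) * y + z)) ≡ (a + y) + (k * (x + y) + (l * y + z))
    identity = ℕ-Solver.solve-∀

digit-↔ : ∀ M → NonZero M → (Fin M × ℕ) ↔ ℕ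
digit-↔ M M≢0 = mk↔ₛ′ to′ (λ n → fromℕ< (m%n<n n M) , n / M) to-from (λ x → to-injective _ x (to-from (to′ x)))
  where
  instance _ = M≢0
  to′ : Fin M × ℕ → ℕ
  to′ (r , k) = toℕ r + k * M
  to-from : ∀ n → to′ (fromℕ< (m%n<n n M) , n / M) ≡ n
  to-from n = trans (cong (_+ n / M * M) (Fin.toℕ-fromℕ< (m%n<n n M))) (sym (m≡m%n+[m/n]*n n M))
  to-injective : ∀ x y → to′ x ≡ to′ y → x ≡ y
  to-injective (r , k) (s , l) eq with Fin.toℕ-injective (trans (sym (remainder r k)) (trans (cong (_% M) eq) (remainder s l)))
    where
    remainder : ∀ r k → to′ (r , k) % M ≡ toℕ r
    remainder r k = trans ([m+kn]%n≡m%n (toℕ r) k M) (m<n⇒m%n≡m (Fin.toℕ<n r))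
  ... | refl = cong (r ,_) (ℕ.*-cancelʳ-≡ k l M (ℕ.+-cancelˡ-≡ (toℕ r) _ _ eq))

Digits : ∀ {d} → Vec ℕ d → Set
Digits []       = ⊤
Digits (M ∷ Ms) = Fin M × Digits Ms

Finite-Digits : ∀ {d} (Ms : Vec ℕ d) → Finite (Digits Ms)
Finite-Digits []       = Finite-⊤
Finite-Digits (M ∷ Ms) = Finite-Σ Finite-Fin (λ _ → Finite-Digits Ms)

digits-↔ : ∀ {d} {Ms : Vec ℕ d} → All NonZero Ms → (Digits Ms × Vec ℕ d) ↔ Vec ℕ d
digits-↔ [] = mk↔ₛ′ proj₂ (tt ,_) (λ _ → refl) (λ _ → refl)
digits-↔ {Ms = M ∷ Ms} (M≢0 ∷ Ms≢0) = regroup ⨾ ×-cong (digit-↔ M M≢0) (digits-↔ Ms≢0) ⨾ ∷-↔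
  where
  regroup : ((Fin M × Digits Ms) × Vec ℕ (suc _)) ↔ ((Fin M × ℕ) × (Digits Ms × Vec ℕ _))
  regroup = mk↔ₛ′ (λ { ((r , rs) , k ∷ w) → (r , k) , (rs , w) }) (λ ((r , k) , (rs , w)) → (r , rs) , k ∷ w)
    (λ _ → refl) (λ { ((r , rs) , k ∷ w) → refl })

digit-values : ∀ {d} (Ms : Vec ℕ d) → Digits Ms → Vec ℕ d
digit-values []       _        = []
digit-values (M ∷ Ms) (r , rs) = toℕ r ∷ digit-values Ms rs

-- Division with remainder of each coefficient moves the remainder into the base and multiplies the
-- generator by the modulus. Equal moduli make a part constant modulo `M`; individual moduli serve
-- to equalise the values of a form on the generators.
digit-split : ∀ {n d} {Ms : Vec ℕ d} → All NonZero Ms → (b : Vec ℕ n) (vs : Vec _ d) → Split (piece b vs)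
digit-split {Ms = Ms} Ms≢0 b vs = record
  { Index = Digits Ms ; finite = Finite-Digits Ms
  ; part = λ r → piece (b ⊞ span vs (digit-values Ms r)) (zipWith _·_ Ms vs)
  ; reindex = digits-↔ Ms≢0
  ; point-reindex = λ r w → trans (cong (b ⊞_) (span-digits Ms≢0 vs r w)) (⊞-assoc b _ _) }
  where
  ⊞-assoc : ∀ {n} (a b c : Vec ℕ n) → a ⊞ (b ⊞ c) ≡ a ⊞ b ⊞ c
  ⊞-assoc []      []      []      = refl
  ⊞-assoc (x ∷ a) (y ∷ b) (z ∷ c) = cong₂ _∷_ (sym (ℕ.+-assoc x y z)) (⊞-assoc a b c)

  rearrange : ∀ {n} r k M (v s t : Vec ℕ n) →
    (r + k * M) · v ⊞ (s ⊞ t) ≡ r · v ⊞ s ⊞ (k · (M · v) ⊞ t)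
  rearrange r k M []      []      []      = refl
  rearrange r k M (x ∷ v) (y ∷ s) (z ∷ t) = cong₂ _∷_ (identity r k M x y z) (rearrange r k M v s t)
    where
    identity : ∀ r k M x y z → (r + k * M) * x + (y + z) ≡ r * x + y + (k * (M * x) + z)
    identity = ℕ-Solver.solve-∀

  span-digits : ∀ {n d} {Ms : Vec ℕ d} (Ms≢0 : All NonZero Ms) (vs : Vec (Vec ℕ n) d) r w →
    span vs (Inverse.to (digits-↔ Ms≢0) (r , w)) ≡ span vs (digit-values Ms r) ⊞ span (zipWith _·_ Ms vs) w
  span-digits []           []       _        []      = sym (⊞-identityʳ origin)
  span-digits {Ms = M ∷ Ms} (_ ∷ Ms≢0) (v ∷ vs) (r , rs) (k ∷ w) =
    trans (cong ((toℕ r + k * M) · v ⊞_) (span-digits Ms≢0 vs rs w))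
          (rearrange (toℕ r) k M v (span vs (digit-values Ms rs)) (span (zipWith _·_ Ms vs) w))

span-multiple : ∀ {n d} M (vs : Vec (Vec ℕ n) d) w →
                span (zipWith _·_ (replicate d M) vs) w ≡ M · span vs w
span-multiple M []       []      = sym (multiple-origin M)
span-multiple M (v ∷ vs) (k ∷ w) = trans (cong (k · (M · v) ⊞_) (span-multiple M vs w)) (factor-out k M v (span vs w))
  where
  factor-out : ∀ {n} k M (v s : Vec ℕ n) → k · (M · v) ⊞ M · s ≡ M · (k · v ⊞ s)
  factor-out k M []      []      = refl
  factor-out k M (x ∷ v) (y ∷ s) = cong₂ _∷_ (identity k M x y) (factor-out k M v s)
    where
    identity : ∀ k M x y → k * (M * x) + M * y ≡ M * (k * x + y)
    identity = ℕ-Solver.solve-∀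

refinable-mod : ∀ {n} M → NonZero M → Refinable {n} (λ x y → x ≡ y mod M)
refinable-mod M M≢0 (piece b vs) = node (digit-split (all-replicate M≢0) b vs) λ r → leaf λ w w′ →
  subst₂ (λ x y → _ ⊞ x ≡ _ ⊞ y mod M) (sym (span-multiple M vs w)) (sym (span-multiple M vs w′))
    (congruent-multiples _ (span vs w) (span vs w′))
  where
  all-replicate : ∀ {d M} → NonZero M → All NonZero (replicate d M)
  all-replicate {zero}  p = []
  all-replicate {suc d} p = p ∷ all-replicate p

  congruent-multiples : ∀ {n} (b v w : Vec ℕ n) → (b ⊞ M · v) ≡ (b ⊞ M · w) mod M
  congruent-multiples []      []      []      = residues []
  congruent-multiples (x ∷ b) (y ∷ v) (z ∷ w) = mod-∷ (+ z ℤ.- + y , eq) (congruent-multiples b v w)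
    where
    identity : ∀ x y z m → x ℤ.+ m ℤ.* z ≡ x ℤ.+ m ℤ.* y ℤ.+ m ℤ.* (z ℤ.- y)
    identity = solve-∀
    eq : + (x + M * z) ≡ + (x + M * y) ℤ.+ + M ℤ.* (+ z ℤ.- + y)
    eq = trans (cong (ℤ._+_ (+ x)) (ℤ.pos-* M z)) (trans (identity (+ x) (+ y) (+ z) (+ M))
      (cong (λ t → + x ℤ.+ t ℤ.+ + M ℤ.* (+ z ℤ.- + y)) (sym (ℤ.pos-* M y))))

-- Making the sign of a form constant

SameSign : ∀ {n} → Form n → Vec ℕ n → Vec ℕ n → Set
SameSign ℓ x y = sgn (⟪ ℓ ⟫ x) ≡ sgn (⟪ ℓ ⟫ y)

NonNegative : ℤ → Set
NonNegative i = ∃ λ k → i ≡ + k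

-- Strictly decreases when a non-positive i is increased, whatever the increment.
deficit : ℤ → ℕ
deficit (+ 0)    = 1
deficit +[1+ _ ] = 0
deficit -[1+ n ] = 2 + n

deficit-⊖ : ∀ m n → deficit (m ℤ.⊖ n) ≤ suc n
deficit-⊖ zero    zero    = ℕ.≤-refl
deficit-⊖ zero    (suc n) = ℕ.≤-refl
deficit-⊖ (suc m) zero    = z≤n
deficit-⊖ (suc m) (suc n) = subst (λ i → deficit i ≤ suc (suc n)) (sym (ℤ.[1+m]⊖[1+n]≡m⊖n m n)) (ℕ.m≤n⇒m≤1+n (deficit-⊖ m n))

deficit-+ : ∀ i {m} → ∀ {fuel} → deficit i ≡ suc fuel → deficit (i ℤ.+ +[1+ m ]) ≤ fuel
deficit-+ (+ 0)    eq = z≤n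
deficit-+ -[1+ n ] {m} refl = subst (λ i → deficit i ≤ suc n) (sym (ℤ.[1+m]⊖[1+n]≡m⊖n m n)) (deficit-⊖ m n)

module _ {n} (ℓ : Form n) where
  private
    val : Vec ℕ n → ℤ
    val = lin (coefs ℓ)

  span-zero : ∀ {d} {vs : Vec _ d} → All (λ v → val v ≡ 0ℤ) vs → ∀ w → val (span vs w) ≡ 0ℤ
  span-zero []                []      = lin-origin (coefs ℓ)
  span-zero {vs = v ∷ vs} (v≡0 ∷ vs≡0) (k ∷ w)
    rewrite lin-⊞ (coefs ℓ) (k · v) (span vs w) | lin-· (coefs ℓ) k v | v≡0 | span-zero vs≡0 w | ℤ.*-zeroʳ (+ k) = refl

  span-nonnegative : ∀ {d} {vs : Vec _ d} → All (NonNegative ∘ val) vs → ∀ w → NonNegative (val (span vs w))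
  span-nonnegative []                []      = 0 , lin-origin (coefs ℓ)
  span-nonnegative {vs = v ∷ vs} ((m , v≡m) ∷ vs≥0) (k ∷ w) with span-nonnegative vs≥0 w
  ... | m′ , eq = k * m + m′ , trans (lin-⊞ (coefs ℓ) (k · v) (span vs w))
    (cong₂ ℤ._+_ (trans (lin-· (coefs ℓ) k v) (trans (cong (ℤ._*_ (+ k)) v≡m) (sym (ℤ.pos-* k m)))) eq)

  positive-or-deficient : ∀ i → (∃ λ m → i ≡ +[1+ m ]) ⊎ (∃ λ c → deficit i ≡ suc c)
  positive-or-deficient (+ 0)    = inj₂ (0 , refl)
  positive-or-deficient +[1+ m ] = inj₁ (m , refl)
  positive-or-deficient -[1+ m ] = inj₂ (suc m , refl)

  -- A positive value at the base stays positive, and if all generators have value 0 the form is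
  -- constant. Otherwise a generator of positive value is brought to the front: with coefficient 0
  -- it is dropped, and with a positive coefficient it raises the value at the base, which lowers
  -- `deficit`.
  nonnegative-decomposition : ∀ fuel {d} b (vs : Vec _ d) → All (NonNegative ∘ val) vs → deficit (⟪ ℓ ⟫ b) ≤ fuel →
                              Decomposition (SameSign ℓ) (piece b vs)
  nonnegative-decomposition fuel b vs vs≥0 le with positive-or-deficient (⟪ ℓ ⟫ b)
  ... | inj₁ (m , b≡m) = leaf λ w w′ → trans (positive w) (sym (positive w′))
    where
    positive : ∀ w → sgn (⟪ ℓ ⟫ (b ⊞ span vs w)) ≡ 1ℤ
    positive w = cong sgn (trans (⟪⟫-⊞ ℓ b (span vs w)) (cong₂ ℤ._+_ b≡m (proj₂ (span-nonnegative vs≥0 w))))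
  ... | inj₂ (c , b≡c)
    with search {P = λ v → val v ≡ 0ℤ} {Q = λ v → ∃ λ m → val v ≡ +[1+ m ]} (All.map classify vs≥0)
    where
    classify : ∀ {v} → NonNegative (val v) → val v ≡ 0ℤ ⊎ ∃ λ m → val v ≡ +[1+ m ]
    classify (zero  , eq) = inj₁ eq
    classify (suc m , eq) = inj₂ (m , eq)
  ... | inj₁ vs≡0 = leaf λ w w′ → trans (constant-value w) (sym (constant-value w′))
    where
    constant-value : ∀ w → sgn (⟪ ℓ ⟫ (b ⊞ span vs w)) ≡ sgn (⟪ ℓ ⟫ b)
    constant-value w = cong sgn (trans (⟪⟫-⊞ ℓ b (span vs w))
      (trans (cong (ℤ._+_ (⟪ ℓ ⟫ b)) (span-zero vs≡0 w)) (ℤ.+-identityʳ _)))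
  ... | inj₂ (found {a = v} {as} s (m , v≡m)) = reorder s (node (zero-split b v as) λ
    { true  → nonnegative-decomposition fuel b as (proj₂ (all-select s vs≥0)) le
    ; false → shifted fuel le })
    where
    shifted : ∀ fuel → deficit (⟪ ℓ ⟫ b) ≤ fuel → Decomposition (SameSign ℓ) (piece (b ⊞ v) (v ∷ as))
    shifted zero       le = contradiction (trans (sym b≡c) (ℕ.n≤0⇒n≡0 le)) λ ()
    shifted (suc fuel) le = nonnegative-decomposition fuel (b ⊞ v) (v ∷ as)
      ((suc m , v≡m) ∷ proj₂ (all-select s vs≥0))
      (subst (λ i → deficit i ≤ fuel) (sym (trans (⟪⟫-⊞ ℓ b v) (cong (ℤ._+_ (⟪ ℓ ⟫ b)) v≡m)))
        (ℕ.≤-trans (deficit-+ (⟪ ℓ ⟫ b) b≡c) (s≤s⁻¹ (subst (_≤ suc fuel) b≡c le))))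

negated : ∀ {n} → Form n → Form n
negated ℓ = form (combine -1ℤ (coefs ℓ) 0ℤ (coefs ℓ)) (ℤ.- constant ℓ)

lin-negated : ∀ {n} (ℓ : Form n) x → lin (coefs (negated ℓ)) x ≡ ℤ.- lin (coefs ℓ) x
lin-negated ℓ x = trans (lin-combine -1ℤ (coefs ℓ) 0ℤ (coefs ℓ) x)
  (trans (ℤ.+-identityʳ _) (ℤ.-1*i≡-i (lin (coefs ℓ) x)))

sgn-negated : ∀ {n} (ℓ : Form n) x → sgn (⟪ negated ℓ ⟫ x) ≡ ℤ.- sgn (⟪ ℓ ⟫ x)
sgn-negated ℓ x = trans (cong sgn (trans (cong (ℤ._+ ℤ.- constant ℓ) (lin-negated ℓ x))
  (sym (ℤ.neg-distrib-+ (lin (coefs ℓ) x) (constant ℓ))))) (sgn-neg (⟪ ℓ ⟫ x))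

data Balanced (K : ℕ) (i : ℤ) : Set where
  positive : i ≡ + K → Balanced K i
  null     : i ≡ 0ℤ → Balanced K i
  negative : i ≡ ℤ.- + K → Balanced K i

module _ {n} (ℓ : Form n) where
  private
    val : Vec ℕ n → ℤ
    val = lin (coefs ℓ)

  weight : ∀ {d} → Vec (Vec ℕ n) d → ℕ
  weight vs = sum (map (∣_∣ ∘ val) vs)

  weight-select : ∀ {d v} {vs : Vec _ d} {us} → Select v vs us → weight us ≡ ∣ val v ∣ + weight vs
  weight-select here = refl
  weight-select {v = v} (there {b = u} {as = vs} s) =
    trans (cong (λ k → ∣ val u ∣ + k) (weight-select s)) (exchange ∣ val u ∣ ∣ val v ∣ (weight vs))
    where
    exchange : ∀ a b c → a + (b + c) ≡ b + (a + c)
    exchange = ℕ-Solver.solve-∀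

  -- When all values are 0 or ±K, comparing opposite generators creates one of value 0, so the weight drops;
  -- for values of different size it may grow.
  balanced-decomposition : ∀ K → NonZero K → ∀ fuel {d} b (vs : Vec _ d) → All (Balanced K ∘ val) vs → weight vs ≤ fuel →
                           Decomposition (SameSign ℓ) (piece b vs)
  balanced-decomposition K K≢0 fuel b vs bal le
    -- If no generator has value `+ K`, all values are at most 0, and the negated form falls under
    -- the non-negative case.
    with search {P = NonNegative ∘ lin (coefs (negated ℓ))} {Q = λ v → val v ≡ + K} (All.map (λ {v} → classify v) bal)
    where
    classify : ∀ v → Balanced K (val v) → NonNegative (lin (coefs (negated ℓ)) v) ⊎ val v ≡ + K
    classify v (positive eq) = inj₂ eq
    classify v (null eq)     = inj₁ (0 , trans (lin-negated ℓ v) (cong ℤ.-_ eq))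
    classify v (negative eq) = inj₁ (K , trans (lin-negated ℓ v) (trans (cong ℤ.-_ eq) (ℤ.neg-involutive (+ K))))
  ... | inj₁ vs≤0 = decomposition-map
    (λ x y same → ℤ.neg-injective (trans (sym (sgn-negated ℓ x)) (trans same (sgn-negated ℓ y))))
    (nonnegative-decomposition (negated ℓ) _ b vs vs≤0 ℕ.≤-refl)
  ... | inj₂ (found {a = v} {us} s v≡K)
    with search {P = NonNegative ∘ val} {Q = λ v → val v ≡ ℤ.- + K} (All.map classify (proj₂ (all-select s bal)))
    where
    classify : ∀ {v} → Balanced K (val v) → NonNegative (val v) ⊎ val v ≡ ℤ.- + K
    classify (positive eq) = inj₁ (K , eq)
    classify (null eq)     = inj₁ (0 , eq)
    classify (negative eq) = inj₂ eq
  ... | inj₁ us≥0 = reorder s (nonnegative-decomposition ℓ _ b (v ∷ us) ((K , v≡K) ∷ us≥0) ℕ.≤-refl)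
  ... | inj₂ (found {a = w} {ts} t w≡-K) = reorder s (reorder (there t) (node (compare-split b w v ts) λ
    { true  → lighter fuel b (w ∷ w ⊞ v ∷ ts) (negative w≡-K ∷ null w⊞v≡0 ∷ ts-bal) drop-v le
    ; false → lighter fuel (b ⊞ v) (w ⊞ v ∷ v ∷ ts) (null w⊞v≡0 ∷ positive v≡K ∷ ts-bal) drop-w le }))
    where
    ts-bal = proj₂ (all-select t (proj₂ (all-select s bal)))

    w⊞v≡0 : val (w ⊞ v) ≡ 0ℤ
    w⊞v≡0 = trans (lin-⊞ (coefs ℓ) w v) (trans (cong₂ ℤ._+_ w≡-K v≡K) (ℤ.+-inverseˡ (+ K)))

    ∣w∣≡K : ∣ val w ∣ ≡ K
    ∣w∣≡K = trans (cong ∣_∣ w≡-K) (ℤ.∣-i∣≡∣i∣ (+ K))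

    weight-vs : weight vs ≡ K + (K + weight ts)
    weight-vs = trans (weight-select s) (cong₂ _+_ (cong ∣_∣ v≡K)
      (trans (weight-select t) (cong (λ k → k + weight ts) ∣w∣≡K)))

    drop-v : weight vs ≡ K + weight (w ∷ w ⊞ v ∷ ts)
    drop-v = trans weight-vs (cong (λ k → K + k) (cong₂ (λ k j → k + (∣ j ∣ + weight ts)) (sym ∣w∣≡K) (sym w⊞v≡0)))

    drop-w : weight vs ≡ K + weight (w ⊞ v ∷ v ∷ ts)
    drop-w = trans weight-vs (cong (λ k → K + k) (cong₂ (λ i j → ∣ i ∣ + (∣ j ∣ + weight ts)) (sym w⊞v≡0) (sym v≡K)))

    lighter : ∀ fuel {d} b (us : Vec _ d) → All (Balanced K ∘ val) us → weight vs ≡ K + weight us → weight vs ≤ fuel →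
              Decomposition (SameSign ℓ) (piece b us)
    lighter fuel b us bal eq le with ℕ.≤-trans (ℕ.+-monoˡ-≤ (weight us) (>-nonZero⁻¹ K {{K≢0}})) (subst (_≤ fuel) eq le)
    lighter (suc fuel) b us bal eq le | s≤s le′ = balanced-decomposition K K≢0 fuel b us bal le′

  -- The multiplier of `v` is the cofactor of `∣ val v ∣` in `K`, or 1 if `val v` is 0, so all
  -- nonzero values become `K` or its negative.
  balance : ∀ {d} K → NonZero K → (vs : Vec _ d) → All (λ v → val v ≡ 0ℤ ⊎ ∣ val v ∣ ∣ K) vs →
            ∃ λ Ns → All NonZero Ns × All (Balanced K ∘ val) (zipWith _·_ Ns vs)
  balance K K≢0 []       []       = [] , [] , []
  balance K K≢0 (v ∷ vs) (h ∷ hs) with balance K K≢0 vs hs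
  ... | Ns , Ns≢0 , bal = let (N , N≢0 , b) = scale h in N ∷ Ns , N≢0 ∷ Ns≢0 , b ∷ bal
    where
    scale : val v ≡ 0ℤ ⊎ ∣ val v ∣ ∣ K → ∃ λ N → NonZero N × Balanced K (val (N · v))
    scale (inj₁ v≡0) = 1 , _ , null (trans (lin-· (coefs ℓ) 1 v) (trans (ℤ.*-identityˡ _) v≡0))
    scale (inj₂ (divides N K≡N∣v∣)) = N , ℕ.m*n≢0⇒m≢0 N {{subst NonZero K≡N∣v∣ K≢0}} ,
      classify (ℤ.+∣i∣≡i⊎+∣i∣≡-i (val v))
      where
      scaled : val (N · v) ≡ + N ℤ.* val v
      scaled = lin-· (coefs ℓ) N v
      +K : + K ≡ + N ℤ.* + ∣ val v ∣
      +K = trans (cong +_ K≡N∣v∣) (ℤ.pos-* N ∣ val v ∣)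
      classify : + ∣ val v ∣ ≡ val v ⊎ + ∣ val v ∣ ≡ ℤ.- val v → Balanced K (val (N · v))
      classify (inj₁ eq) = positive (trans scaled (sym (trans +K (cong (ℤ._*_ (+ N)) eq))))
      classify (inj₂ eq) = negative (trans scaled (sym (trans (cong ℤ.-_ (trans +K (cong (ℤ._*_ (+ N)) eq)))
        (trans (ℤ.neg-distribʳ-* (+ N) (ℤ.- val v)) (cong (ℤ._*_ (+ N)) (ℤ.neg-involutive (val v)))))))

  common-multiple : ∀ {d} (vs : Vec (Vec ℕ n) d) →
                    ∃ λ K → NonZero K × All (λ v → val v ≡ 0ℤ ⊎ ∣ val v ∣ ∣ K) vs
  common-multiple []       = 1 , _ , []
  common-multiple (v ∷ vs) with common-multiple vs
  ... | K , K≢0 , hs = factor ∣ val v ∣ * K , ℕ.m*n≢0 _ _ {{factor≢0 ∣ val v ∣}} {{K≢0}} ,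
    divisor (val v) ∷ All.map (Sum.map₂ (∣n⇒∣m*n (factor ∣ val v ∣))) hs
    where
    divisor : ∀ i → i ≡ 0ℤ ⊎ ∣ i ∣ ∣ (factor ∣ i ∣ * K)
    divisor (+ 0)    = inj₁ refl
    divisor +[1+ m ] = inj₂ (m∣m*n K)
    divisor -[1+ m ] = inj₂ (m∣m*n K)

  -- Residues of the coefficients modulo the multipliers from `balance` go into the base, and what
  -- remains are pieces with balanced generators.
  refinable-sign : Refinable (SameSign ℓ)
  refinable-sign (piece b vs) with common-multiple vs
  ... | K , K≢0 , hs with balance K K≢0 vs hs
  ... | Ns , Ns≢0 , bal = node (digit-split Ns≢0 b vs) λ r → balanced-decomposition K K≢0 _ _ _ bal ℕ.≤-refl

refinable-similar : ∀ {n} M → NonZero M → (L : List (Form n)) → Refinable (Similar M L)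
refinable-similar M M≢0 [] p = decomposition-map
  (λ x y c → record { congruent = c ; sameSigns = λ () }) (refinable-mod M M≢0 p)
refinable-similar M M≢0 (ℓ ∷ L) p = decomposition-map
  (λ x y (same , s) → record { congruent = congruent s
                             ; sameSigns = λ { (here refl) → same ; (there ℓ∈L) → sameSigns s ℓ∈L } })
  (refinable-× (refinable-sign ℓ) (refinable-similar M M≢0 L) p)

-- Parametrisation of good sets

unit-vectors : ∀ n → Vec (Vec ℕ n) n
unit-vectors zero    = []
unit-vectors (suc n) = (1 ∷ origin) ∷ map (0 ∷_) (unit-vectors n)

span-unit-vectors : ∀ {n} (w : Vec ℕ n) → span (unit-vectors n) w ≡ w
span-unit-vectors []      = refl
span-unit-vectors {suc n} (k ∷ w) = trans (cong ((k · (1 ∷ origin)) ⊞_) (span-0∷ (unit-vectors n) w))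
  (cong₂ _∷_ (trans (ℕ.+-identityʳ _) (ℕ.*-identityʳ k))
    (trans (cong₂ _⊞_ (multiple-origin k) (span-unit-vectors w)) (⊞-identityˡ w)))
  where
  span-0∷ : ∀ {n d} (vs : Vec (Vec ℕ n) d) w → span (map (0 ∷_) vs) w ≡ 0 ∷ span vs w
  span-0∷ []       []      = refl
  span-0∷ (v ∷ vs) (k ∷ w) rewrite span-0∷ vs w | ℕ.*-zeroʳ k = refl

-- `param` expresses both the disjointness of the pieces and the injectivity of each affine map. The
-- pieces are numbered so that contributions can be summed over them.
record Parametrisation {n} (P : Vec ℕ n → Set) : Set where
  field
    pieces      : ℕ
    component   : Fin pieces → Piece n
    param       : Σ (Fin pieces) (Parameter ∘ component) ↔ Refinement (Vec ℕ n) P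
    value-param : ∀ i w → value (Inverse.to param (i , w)) ≡ point (component i) w

module _ (em : ExcludedMiddle 0ℓ) where
  open Classical em

  parametrise : ∀ {n} {P : Vec ℕ n → Set} → Good P → Parametrisation P
  parametrise {n} {P} good = record
    { pieces = proj₁ finite-Holding
    ; component = λ i → part S (value (Inverse.from (proj₂ finite-Holding) i))
    ; param  = Σ-↔ (↔-sym (proj₂ finite-Holding)) (↔-id _) ⨾ image
    ; value-param = λ i w → refl }
    where
    module G = Good good
    D = refinable-similar G.modulus G.modulus≢0 G.forms (piece origin (unit-vectors n))
    S = split D
    module R = Inverse (reindex S)

    -- By homogeneity, testing the single point at parameter `origin` decides the whole part.
    Holding : Set
    Holding = Refinement (Index S) (λ i → P (point (part S i) origin))

    finite-Holding : Finite Holding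
    finite-Holding = Finite-injection (finite S) value refinement-≡

    point-R : ∀ i w → point (part S i) w ≡ R.to (i , w)
    point-R i w = trans (sym (point-reindex S i w)) (trans (⊞-identityˡ _) (span-unit-vectors _))

    transfer : ∀ i w w′ → P (point (part S i) w) → P (point (part S i) w′)
    transfer i w w′ = G.transfer (homogeneous D i w w′)

    inject : ∀ {j j′ : Holding} {w w′} → _≡_ {A = Σ (Index S) (Parameter ∘ part S)} (value j , w) (value j′ , w′) →
             _≡_ {A = Σ Holding (Parameter ∘ part S ∘ value)} (j , w) (j′ , w′)
    inject refl = refl

    image : Σ Holding (Parameter ∘ part S ∘ value) ↔ Refinement (Vec ℕ n) P
    image = image-↔
      (λ (j , w) → point (part S (value j)) w)
      (λ {(j , w)} {(j′ , w′)} eq → inject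
        (trans (sym (R.strictlyInverseʳ _)) (trans (cong R.from
          (trans (sym (point-R (value j) w)) (trans eq (point-R (value j′) w′)))) (R.strictlyInverseʳ _))))
      (λ (j , w) → transfer (value j) origin w (holds j))
      (λ x p → let (i , w) = R.from x
                   eq = trans (point-R i w) (R.strictlyInverseˡ x)
               in (refined i (transfer i w origin (subst P (sym eq) p)) , w) , eq)

-- Generalised vector partition functions

shift : ∀ {n} → Vec ℕ n → Vec ℤ n → Vec ℤ n
shift = zipWith (λ a b → + a ℤ.+ b)

-- Each alternative speaks of all `ψ` at once, since the recursion replaces `ψ` by `ψ ∘ (k ∷_)`.
zeroExtend-cases : ∀ {n} (z : Vec ℤ n) →
  (∃ λ x → z ≡ map +_ x × (∀ ψ → zeroExtend ψ z ≡ ψ x)) ⊎ ((∀ ψ → zeroExtend ψ z ≡ 0) × (∀ x → z ≢ map +_ x))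
zeroExtend-cases []             = inj₁ ([] , refl , λ ψ → refl)
zeroExtend-cases (+ k ∷ z)      with zeroExtend-cases z
... | inj₁ (x , eq , h)         = inj₁ (k ∷ x , cong (+ k ∷_) eq , λ ψ → h (ψ ∘ (k ∷_)))
... | inj₂ (h , ≢)              = inj₂ ((λ ψ → h (ψ ∘ (k ∷_))) , λ { (_ ∷ x) eq → ≢ x (cong Vec.tail eq) })
zeroExtend-cases (-[1+ k ] ∷ z) = inj₂ ((λ ψ → refl) , λ { (_ ∷ x) () })

+-injective : ∀ {n} {x y : Vec ℕ n} → map +_ x ≡ map +_ y → x ≡ y
+-injective {x = []}    {[]}    eq = refl
+-injective {x = a ∷ x} {b ∷ y} eq = cong₂ _∷_ (ℤ.+-injective (cong Vec.head eq)) (+-injective (cong Vec.tail eq))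

module PartitionFunctions (em : ExcludedMiddle 0ℓ) where
  open Classical em

  -- Read in ℤⁿ, the equation has no solution when `z` has a negative entry, in agreement with the
  -- value 0 of `zeroExtend`.
  zeroExtend-↔ : ∀ {n m} (A : Matrix n m) {ψ} → IsVectorPartitionFunction A ψ → ∀ z →
                 Refinement (Vec ℕ m) (λ y → z ≡ map +_ (A *ᵥ y)) ↔ Fin (zeroExtend ψ z)
  zeroExtend-↔ A {ψ} isVPF z with zeroExtend-cases z
  ... | inj₁ (x , refl , h) = Refinement-cong-↔ (λ y → +-injective) (λ y → cong (λ v → map +_ v))
                              ⨾ isVPF x ⨾ ↔-subst Fin (sym (h ψ))
  ... | inj₂ (h , ≢)        = mk↔ₛ′ (λ r → contradiction (holds r) (≢ _)) (λ i → contradiction (subst Fin (h ψ) i) λ ())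
                                (λ i → contradiction (subst Fin (h ψ) i) λ ()) (λ r → contradiction (holds r) (≢ _))

  module _ {n} {g : Vec ℕ n → ℕ} (gvpf : IsGeneralisedVPF g) where
    open IsGeneralisedVPF gvpf

    Solution : Vec ℕ n → Fin s → Set
    Solution x i = Refinement (Vec ℕ (m i)) (λ y → shift x (c i) ≡ map +_ (A i *ᵥ y))

    -- The elements of `𝔈 g` become triples of a class `x`, a summand `i` and a solution `y`. Both
    -- directions of the theorem use these triples of numerical data in place of `Fin (g x)`.
    solutions-↔ : Σ (Vec ℕ n) (Fin ∘ g) ↔ Σ (Vec ℕ n) λ x → Σ (Fin s) (Solution x)
    solutions-↔ = Σ-cong₂-↔ λ x → ↔-subst Fin (g≡∑ x) ⨾ ↔-sym (Σ-Fin-↔ _)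
                    ⨾ Σ-cong₂-↔ (λ i → ↔-sym (zeroExtend-↔ (A i) (isVPF i) (shift x (c i))))

columns : ∀ {n d} → Vec (Vec ℕ n) d → Matrix n d
columns []       = replicate _ []
columns (v ∷ vs) = zipWith _∷_ v (columns vs)

columns-*ᵥ : ∀ {n d} (vs : Vec (Vec ℕ n) d) w → columns vs *ᵥ w ≡ span vs w
columns-*ᵥ []       []      = empty-columns _
  where
  empty-columns : ∀ n → replicate n [] *ᵥ [] ≡ origin
  empty-columns zero    = refl
  empty-columns (suc n) = cong (0 ∷_) (empty-columns n)
columns-*ᵥ (v ∷ vs) (k ∷ w) = trans (first-column v (columns vs)) (cong (k · v ⊞_) (columns-*ᵥ vs w))
  where
  first-column : ∀ {n} (v : Vec ℕ n) M → zipWith _∷_ v M *ᵥ (k ∷ w) ≡ k · v ⊞ M *ᵥ w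
  first-column []      []      = refl
  first-column (x ∷ v) (r ∷ M) = cong₂ _∷_ (cong (_+ sum (zipWith _*_ r w)) (ℕ.*-comm x k)) (first-column v M)

-- A piece with base `b` contributes the solutions `y` of `x = b + A y`; moving `b` to the left
-- turns it into the shift by its negative.
shift-neg : ∀ {n} (x b t : Vec ℕ n) → x ≡ b ⊞ t → shift x (map (λ k → ℤ.- + k) b) ≡ map +_ t
shift-neg []      []      []      eq   = refl
shift-neg (x ∷ xs) (b ∷ bs) (t ∷ ts) eq with cong Vec.head eq
... | refl = cong₂ _∷_ (identity (+ b) (+ t)) (shift-neg xs bs ts (cong Vec.tail eq))
  where
  identity : ∀ b t → b ℤ.+ t ℤ.- b ≡ t
  identity = solve-∀

shift-neg⁻¹ : ∀ {n} (x b t : Vec ℕ n) → shift x (map (λ k → ℤ.- + k) b) ≡ map +_ t → x ≡ b ⊞ t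
shift-neg⁻¹ []       []       []       eq = refl
shift-neg⁻¹ (x ∷ xs) (b ∷ bs) (t ∷ ts) eq = cong₂ _∷_
  (ℤ.+-injective (trans (identity (+ x) (+ b)) (cong (ℤ._+_ (+ b)) (cong Vec.head eq))))
  (shift-neg⁻¹ xs bs ts (cong Vec.tail eq))
  where
  identity : ∀ x b → x ≡ b ℤ.+ (x ℤ.- b)
  identity = solve-∀

take-point : ∀ k {n} (p : Piece (k + n)) w → take k (point p w) ≡ take k (base p) ⊞ columns (map (take k) (gens p)) *ᵥ w
take-point k (piece b vs) w = trans (Vec.take-zipWith _+_ b (span vs w)) (cong (take k b ⊞_)
  (trans (take-span vs w) (sym (columns-*ᵥ (map (take k) vs) w))))
  where
  take-origin : ∀ k {n} → take k (origin {k + n}) ≡ origin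
  take-origin zero    = refl
  take-origin (suc k) = cong (0 ∷_) (take-origin k)

  take-span : ∀ {d} (vs : Vec (Vec ℕ (k + _)) d) w → take k (span vs w) ≡ span (map (take k) vs) w
  take-span []       []      = take-origin k
  take-span (v ∷ vs) (l ∷ w) = trans (Vec.take-zipWith _+_ (l · v) (span vs w))
    (cong₂ _⊞_ (Vec.take-map (l *_) k v) (take-span vs w))

-- Lexicographic order

infix 4 _≼_
_≼_ : ∀ {k} → Vec ℕ k → Vec ℕ k → Set
[]      ≼ []      = ⊤
(a ∷ x) ≼ (b ∷ y) = a < b ⊎ (a ≡ b × x ≼ y)

≼-antisym : ∀ {k} {x y : Vec ℕ k} → x ≼ y → y ≼ x → x ≡ y
≼-antisym {x = []}    {[]}    _          _          = refl
≼-antisym {x = a ∷ x} {b ∷ y} (inj₁ a<b) (inj₁ b<a) = contradiction b<a (ℕ.<-asym a<b)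
≼-antisym {x = a ∷ x} {b ∷ y} (inj₁ a<b) (inj₂ (refl , _)) = contradiction a<b (ℕ.<-irrefl refl)
≼-antisym {x = a ∷ x} {b ∷ y} (inj₂ (refl , _)) (inj₁ b<a) = contradiction b<a (ℕ.<-irrefl refl)
≼-antisym {x = a ∷ x} {b ∷ y} (inj₂ (refl , x≼y)) (inj₂ (_ , y≼x)) = cong (a ∷_) (≼-antisym x≼y y≼x)

module _ (em : ExcludedMiddle 0ℓ) where
  open Classical em

  -- The head is minimised first, then, by recursion, the tail among the members with that head.
  ≼-least : ∀ {k} (S : Vec ℕ k → Set) → ∃ S → ∃ λ x → S x × (∀ y → S y → x ≼ y)
  ≼-least {zero}  S ([] , s)    = [] , s , λ { [] _ → tt }
  ≼-least {suc k} S (a ∷ x , s) with least (λ a → ∃ λ x → S (a ∷ x)) (a , x , s)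
  ... | m , (y , t) , m≤ with ≼-least (λ x → S (m ∷ x)) (y , t)
  ... | z , u , z≼ = m ∷ z , u , λ { (b ∷ w) v → compare-heads b w v (ℕ.m≤n⇒m<n∨m≡n (m≤ b (w , v))) }
    where
    compare-heads : ∀ b w → S (b ∷ w) → m < b ⊎ m ≡ b → (m ∷ z) ≼ (b ∷ w)
    compare-heads b w v (inj₁ m<b)  = inj₁ m<b
    compare-heads b w v (inj₂ refl) = inj₂ (refl , z≼ w v)

good-≼ : ∀ {n k} (σ τ : Vec (Fin n) k) → Good (λ x → x ‼ σ ≼ x ‼ τ)
good-≼ []      []      = good-⊤
good-≼ (i ∷ σ) (j ∷ τ) = good-⊎ (good-< i j) (good-× (good-map (λ x (p , q) → ℕ.≤-antisym p q)
  (λ x eq → ℕ.≤-reflexive eq , ℕ.≤-reflexive (sym eq)) (good-× (good-≤ i j) (good-≤ j i))) (good-≼ σ τ))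

good-All-≤ : ∀ {n k} (j : Fin n) (σ : Vec (Fin n) k) → Good (λ x → All (_≤ lookup x j) (x ‼ σ))
good-All-≤ j []      = good-map (λ _ _ → []) (λ _ _ → tt) good-⊤
good-All-≤ j (i ∷ σ) = good-map (λ x (p , q) → p ∷ q) (λ { x (p ∷ q) → p , q }) (good-× (good-≤ i j) (good-All-≤ j σ))

front : ∀ k {n} → Vec (Fin (k + n)) k
front k = tabulate (_↑ˡ _)

back : ∀ k {n} → Vec (Fin (k + n)) n
back k = tabulate (k ↑ʳ_)

‼-tabulate : ∀ {n k} (x : Vec ℕ n) (f : Fin k → Fin n) → x ‼ tabulate f ≡ tabulate (lookup x ∘ f)
‼-tabulate x f = sym (Vec.tabulate-∘ (lookup x) f)

‼-front : ∀ {k n} (c : Vec ℕ k) (x : Vec ℕ n) → (c Vec.++ x) ‼ front k ≡ c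
‼-front {k} c x = trans (‼-tabulate (c Vec.++ x) (_↑ˡ _)) (trans (Vec.tabulate-cong (Vec.lookup-++ˡ c x)) (Vec.tabulate∘lookup c))

‼-back : ∀ {k n} (c : Vec ℕ k) (x : Vec ℕ n) → (c Vec.++ x) ‼ back k ≡ x
‼-back {k} c x = trans (‼-tabulate (c Vec.++ x) (k ↑ʳ_)) (trans (Vec.tabulate-cong (Vec.lookup-++ʳ c x)) (Vec.tabulate∘lookup x))

‼-weaken : ∀ {k n m} (c : Vec ℕ k) (x : Vec ℕ n) (σ : Vec (Fin n) m) → (c Vec.++ x) ‼ map (k ↑ʳ_) σ ≡ x ‼ σ
‼-weaken {k} c x σ = trans (sym (Vec.map-∘ (lookup (c Vec.++ x)) (k ↑ʳ_) σ)) (Vec.map-cong (Vec.lookup-++ʳ c x) σ)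

‼-suc : ∀ {n k} a (x : Vec ℕ n) (σ : Vec (Fin n) k) → (a ∷ x) ‼ map suc σ ≡ x ‼ σ
‼-suc a x σ = sym (Vec.map-∘ (lookup (a ∷ x)) suc σ)

-- An interpreted equivalence structure is a definable partial equivalence relation on ℕᵏ.
module Presburger⇒VPF (em : ExcludedMiddle 0ℓ) {k : ℕ} (_∼_ : Vec ℕ k → Vec ℕ k → Set)
  (∼-sym : ∀ {a b} → a ∼ b → b ∼ a) (∼-trans : ∀ {a b c} → a ∼ b → b ∼ c → a ∼ c)
  (good-∼ : ∀ {n} (σ τ : Vec (Fin n) k) → Good (λ x → (x ‼ σ) ∼ (x ‼ τ))) where
  open Classical em
  open PartitionFunctions em

  -- A first-order substitute for finiteness of the class of `a`: for subsets of ℕᵏ the two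
  -- conditions coincide.
  Bounded : Vec ℕ k → Set
  Bounded a = ∃ λ B → ∀ c → a ∼ c → All (_≤ B) c

  Bounded-∼ : ∀ {a b} → a ∼ b → Bounded a → Bounded b
  Bounded-∼ a∼b (B , bound) = B , λ c b∼c → bound c (∼-trans a∼b b∼c)

  Representative : Vec ℕ k → Vec ℕ k → Set
  Representative x a = x ∼ a × Bounded a × (∀ c → a ∼ c → x ≼ c)

  Bounds : Vec ℕ k → ℕ → Vec ℕ k → Set
  Bounds a B c = a ∼ c → All (_≤ B) c

  good-Bounded : ∀ {n} (σ : Vec (Fin n) k) → Good (λ x → Bounded (x ‼ σ))
  good-Bounded {n} σ = good-∃ em {P = λ v → ∀ c → Bounds (Vec.tail v ‼ σ) (Vec.head v) c} (good-map
    (λ { (B ∷ x) f c → subst id (weaken x B c) (f c) })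
    (λ { (B ∷ x) f c → subst id (sym (weaken x B c)) (f c) })
    (good-∀* em k (good-→ (λ _ → em) (good-∼ σ′ (front k)) (good-All-≤ (k ↑ʳ zero) (front k)))))
    where
    -- The quantified tuple `c` and the bound `B` precede `x` in the context, so the indices in `σ`
    -- are shifted past both.
    σ′ : Vec (Fin (k + suc n)) k
    σ′ = map (k ↑ʳ_) (map suc σ)

    weaken : ∀ x B c → let ρ = c Vec.++ B ∷ x in
             Bounds (ρ ‼ σ′) (lookup ρ (k ↑ʳ zero)) (ρ ‼ front k) ≡ Bounds (x ‼ σ) B c
    weaken x B c = trans
      (cong₂ (λ a b → Bounds a b ((c Vec.++ B ∷ x) ‼ front k))
        (trans (‼-weaken c (B ∷ x) (map suc σ)) (‼-suc B x σ)) (Vec.lookup-++ʳ c (B ∷ x) zero))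
      (cong (Bounds (x ‼ σ) B) (‼-front c (B ∷ x)))

  Below : Vec ℕ k → Vec ℕ k → Vec ℕ k → Set
  Below x a c = a ∼ c → x ≼ c

  good-least : ∀ {n} (σ τ : Vec (Fin n) k) → Good (λ x → ∀ c → Below (x ‼ σ) (x ‼ τ) c)
  good-least σ τ = good-map
    (λ x f c → subst id (weaken x c) (f c))
    (λ x f c → subst id (sym (weaken x c)) (f c))
    (good-∀* em k (good-→ (λ _ → em) (good-∼ (map (k ↑ʳ_) τ) (front k)) (good-≼ (map (k ↑ʳ_) σ) (front k))))
    where
    weaken : ∀ x c → let ρ = c Vec.++ x in
             Below (ρ ‼ map (k ↑ʳ_) σ) (ρ ‼ map (k ↑ʳ_) τ) (ρ ‼ front k) ≡ Below (x ‼ σ) (x ‼ τ) c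
    weaken x c = trans
      (cong₂ (λ s t → Below s t ((c Vec.++ x) ‼ front k)) (‼-weaken c x σ) (‼-weaken c x τ))
      (cong (Below (x ‼ σ) (x ‼ τ)) (‼-front c x))

  RepresentativePair : Vec ℕ (k + k) → Set
  RepresentativePair v = Representative (take k v) (drop k v)

  good-RepresentativePair : Good RepresentativePair
  good-RepresentativePair = good-map
    (λ v → subst₂ Representative (‼-take v) (‼-drop v))
    (λ v → subst₂ Representative (sym (‼-take v)) (sym (‼-drop v)))
    (good-× (good-∼ (front k) (back k)) (good-× (good-Bounded (back k)) (good-least (front k) (back k))))
    where
    ‼-take : ∀ (v : Vec ℕ (k + k)) → v ‼ front k ≡ take k v
    ‼-take v = trans (cong (_‼ front k) (sym (Vec.take++drop≡id k v))) (‼-front (take k v) (drop k v))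

    ‼-drop : ∀ (v : Vec ℕ (k + k)) → v ‼ back k ≡ drop k v
    ‼-drop v = trans (cong (_‼ back k) (sym (Vec.take++drop≡id k v))) (‼-back (take k v) (drop k v))

  representative : ∀ {a} → a ∼ a → Bounded a → ∃ λ x → Representative x a
  representative {a} a∼a bounded with ≼-least em (a ∼_) (a , a∼a)
  ... | x , a∼x , least-x = x , ∼-sym a∼x , bounded , least-x

  representative-unique : ∀ {x y a b} → Representative x a → Representative y b → a ∼ b → x ≡ y
  representative-unique (x∼a , _ , x≼) (y∼b , _ , y≼) a∼b =
    ≼-antisym (x≼ _ (∼-trans a∼b (∼-sym y∼b))) (y≼ _ (∼-trans (∼-sym a∼b) (∼-sym x∼a)))

  representative-∼ : ∀ {x a b} → Representative x a → Representative x b → a ∼ b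
  representative-∼ (x∼a , _) (x∼b , _) = ∼-trans (∼-sym x∼a) x∼b

  abstract
    parametrisation : Parametrisation RepresentativePair
    parametrisation = parametrise em good-RepresentativePair

  open Parametrisation parametrisation
  private
    module Param = Inverse param

  representative-point : ∀ i w → RepresentativePair (point (component i) w)
  representative-point i w = subst RepresentativePair (value-param i w) (holds (Param.to (i , w)))

  point-injective : ∀ {i w w′} → point (component i) w ≡ point (component i) w′ → w ≡ w′
  point-injective {i} {w} {w′} eq = pair-injectiveʳ (trans (sym (Param.strictlyInverseʳ (i , w)))
    (trans (cong Param.from (refinement-≡ (trans (value-param i w) (trans eq (sym (value-param i w′))))))
      (Param.strictlyInverseʳ (i , w′))))
    where
    pair-injectiveʳ : ∀ {i} {w w′ : Parameter (component i)} → _≡_ {A = Σ (Fin pieces) (Parameter ∘ component)} (i , w) (i , w′) → w ≡ w′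
    pair-injectiveʳ = ,-injectiveʳ-UIP (Decidable⇒UIP.≡-irrelevant Fin._≟_)

  b : Fin pieces → Vec ℕ k
  b i = take k (base (component i))

  A′ : ∀ i → Matrix k (dim (component i))
  A′ i = columns (map (take k) (gens (component i)))

  -- All solutions `y` give points with the same first half, so their second halves lie in one
  -- class, which is bounded. As `point` is injective, bounded second halves leave only finitely
  -- many `y`.
  finite-fibres : ∀ i x → Finite (Refinement (Vec ℕ (dim (component i))) (λ y → x ≡ A′ i *ᵥ y))
  finite-fibres i x with em {∃ λ y → x ≡ A′ i *ᵥ y}
  ... | no ∄ = 0 , mk↔ₛ′ (λ r → contradiction (value r , holds r) ∄) (λ ()) (λ ()) (λ r → contradiction (value r , holds r) ∄)
  ... | yes (y₀ , x≡) with representative-point i y₀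
  ... | rep@(_ , (B , bound) , _) = Finite-bounded B (λ r → drop k (point (component i) (value r)))
    (λ {r} {s} eq → refinement-≡ (point-injective (trans (sym (Vec.take++drop≡id k _))
      (trans (cong₂ Vec._++_ (trans (take-constant r) (sym (take-constant s))) eq) (Vec.take++drop≡id k _)))))
    (λ r → bound _ (representative-∼ rep
      (subst (λ x → Representative x (drop k (point (component i) (value r))))
        (trans (take-constant r) (sym (trans (take-point k (component i) y₀) (cong (b i ⊞_) (sym x≡)))))
        (representative-point i (value r)))))
    where
    take-constant : ∀ (r : Refinement (Vec ℕ (dim (component i))) (λ y → x ≡ A′ i *ᵥ y)) →
                    take k (point (component i) (value r)) ≡ b i ⊞ x
    take-constant r = trans (take-point k (component i) (value r)) (cong (b i ⊞_) (sym (holds r)))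

  c′ : Fin pieces → Vec ℤ k
  c′ i = map (λ n → ℤ.- + n) (b i)

  -- This counts the parameters, over all pieces, whose point has first half `x`: the size of the
  -- finite class with least element `x`, or 0 if there is no such class.
  g : Vec ℕ k → ℕ
  g x = sum (tabulate λ i → zeroExtend (λ x → proj₁ (finite-fibres i x)) (shift x (c′ i)))

  g-gvpf : IsGeneralisedVPF g
  g-gvpf = record { A = A′ ; c = c′ ; isVPF = λ i x → proj₂ (finite-fibres i x) ; g≡∑ = λ x → refl }

  BoundedClasses : Set
  BoundedClasses = Refinement (Vec ℕ k) (λ a → a ∼ a × Bounded a)

  UnboundedClasses : Set
  UnboundedClasses = Refinement (Vec ℕ k) (λ a → a ∼ a × ¬ Bounded a)

  rep : BoundedClasses → Vec ℕ k
  rep a = proj₁ (representative (proj₁ (holds a)) (proj₂ (holds a)))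

  rep-representative : ∀ a → Representative (rep a) (value a)
  rep-representative a = proj₂ (representative (proj₁ (holds a)) (proj₂ (holds a)))

  pairs-↔ : BoundedClasses ↔ Refinement _ RepresentativePair
  pairs-↔ = image-↔ (λ a → rep a Vec.++ value a)
    (λ {a} {a′} eq → refinement-≡ (Vec.++-injectiveʳ (rep a) (rep a′) eq))
    (λ a → subst₂ Representative (sym (take-++ (rep a) (value a))) (sym (drop-++ (rep a) (value a))) (rep-representative a))
    (λ v r@(x∼a , bounded , _) → let a = refined (drop k v) (∼-trans (∼-sym x∼a) x∼a , bounded) in a ,
      trans (cong (Vec._++ drop k v) (representative-unique (rep-representative a) r (∼-trans (∼-sym x∼a) x∼a))) (Vec.take++drop≡id k v))
    where
    take-++ : ∀ {m n} (v : Vec ℕ m) (w : Vec ℕ n) → take m (v Vec.++ w) ≡ v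
    take-++ {m} v w = Vec.++-injectiveˡ (take m (v Vec.++ w)) v (Vec.take++drop≡id m (v Vec.++ w))

    drop-++ : ∀ {m n} (v : Vec ℕ m) (w : Vec ℕ n) → drop m (v Vec.++ w) ≡ w
    drop-++ {m} v w = Vec.++-injectiveʳ (take m (v Vec.++ w)) v (Vec.take++drop≡id m (v Vec.++ w))

  by-class-↔ : Σ (Fin pieces) (Parameter ∘ component) ↔ Σ (Vec ℕ k) λ x → Σ (Fin pieces) (Solution g-gvpf x)
  by-class-↔ = mk↔ₛ′
    (λ (i , w) → take k (point (component i) w) , i , refined w (shift-neg _ (b i) _ (take-point k (component i) w)))
    (λ (x , i , r) → i , value r)
    (λ (x , i , r) → collect (trans (take-point k (component i) (value r)) (sym (shift-neg⁻¹ x (b i) _ (holds r)))))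
    (λ _ → refl)
    where
    collect : ∀ {x x′ i} {w : Vec ℕ (dim (component i))} .{p : shift x (c′ i) ≡ map +_ (A′ i *ᵥ w)} .{p′} → x ≡ x′ →
              _≡_ {A = Σ (Vec ℕ k) λ x → Σ (Fin pieces) (Solution g-gvpf x)} (x , i , refined w p) (x′ , i , refined w p′)
    collect refl = refl

  bounded-↔ : BoundedClasses ↔ Σ (Vec ℕ k) (Fin ∘ g)
  bounded-↔ = pairs-↔ ⨾ ↔-sym param ⨾ by-class-↔ ⨾ ↔-sym (solutions-↔ g-gvpf)

  -- The class of `𝔈 g` that receives `a` is indexed by the least element of the class of `a`, so
  -- the bijection respects equivalence in both directions.
  bounded-↔-proj₁ : ∀ a → proj₁ (Inverse.to bounded-↔ a) ≡ rep a
  bounded-↔-proj₁ a = trans (cong (take k) (trans (sym (value-param i w)) (cong value (Param.strictlyInverseˡ v))))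
    (Vec.++-injectiveˡ (take k (rep a Vec.++ value a)) (rep a) (Vec.take++drop≡id k (rep a Vec.++ value a)))
    where
    v = Inverse.to pairs-↔ a
    i = proj₁ (Param.from v)
    w = proj₂ (Param.from v)

  ℭ : EquivalenceStructure
  ℭ = record
    { Carrier = UnboundedClasses
    ; _≈_ = λ a b → value a ∼ value b
    ; isEquivalence = record { refl = λ {a} → proj₁ (holds a) ; sym = ∼-sym ; trans = ∼-trans } }

  ℭ-countable : Countable ℭ
  ℭ-countable = mk↣ {to = encode ∘ value} (refinement-≡ ∘ encode-injective)

  common-bound : ∀ n (h : Fin n → Vec ℕ k) → ∃ λ B → ∀ i → All (_≤ B) (h i)
  common-bound zero    h = 0 , λ ()
  common-bound (suc n) h with common-bound n (h ∘ suc)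
  ... | B , bound = sum (h zero) + B , λ
    { zero    → All.map (λ le → ℕ.≤-trans le (ℕ.m≤m+n _ B)) (entries (h zero))
    ; (suc i) → All.map (λ le → ℕ.≤-trans le (ℕ.m≤n+m B _)) (bound i) }
    where
    entries : ∀ {k} (v : Vec ℕ k) → All (_≤ sum v) v
    entries []      = []
    entries (x ∷ v) = ℕ.m≤m+n x (sum v) ∷ All.map (λ le → ℕ.≤-trans le (ℕ.m≤n+m (sum v) x)) (entries v)

  -- Finitely many elements have a common bound on their entries. The class of `a` in `ℭ` is its
  -- whole class under `∼`, because boundedness depends only on the class, so such a bound would
  -- contradict unboundedness.
  ℭ-infinite : OnlyInfiniteClasses ℭ
  ℭ-infinite a (n , class-↔) with common-bound n (value ∘ value ∘ Inverse.from class-↔)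
  ... | B , bound = proj₂ (holds a) (B , λ c a∼c →
    let c∼c = ∼-trans (∼-sym a∼c) a∼c
        member = refined (refined c (c∼c , λ bounded → proj₂ (holds a) (Bounded-∼ (∼-sym a∼c) bounded))) a∼c
    in subst (All (_≤ B)) (cong (value ∘ value) (Inverse.strictlyInverseʳ class-↔ member)) (bound (Inverse.to class-↔ member)))

  Carrier : Set
  Carrier = Refinement (Vec ℕ k) (λ a → a ∼ a)

  -- The decision is an argument, so that proofs can distinguish its cases instead of analysing
  -- `em`.
  classify : (a : Carrier) → Dec (Bounded (value a)) → BoundedClasses ⊎ UnboundedClasses
  classify a (yes p) = inj₁ (refined (value a) (holds a , p))
  classify a (no ¬p) = inj₂ (refined (value a) (holds a , ¬p))

  classify-↔ : Carrier ↔ (BoundedClasses ⊎ UnboundedClasses)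
  classify-↔ = mk↔ₛ′ (λ a → classify a em)
    [ (λ a → refined (value a) (proj₁ (holds a))) , (λ a → refined (value a) (proj₁ (holds a))) ]′
    (λ { (inj₁ a) → classify-bounded a em ; (inj₂ a) → classify-unbounded a em })
    (λ a → unclassify a em)
    where
    classify-bounded : ∀ (a : BoundedClasses) d → classify (refined (value a) (proj₁ (holds a))) d ≡ inj₁ a
    classify-bounded a (yes p) = refl
    classify-bounded a (no ¬p) = contradiction (proj₂ (holds a)) ¬p
    classify-unbounded : ∀ (a : UnboundedClasses) d → classify (refined (value a) (proj₁ (holds a))) d ≡ inj₂ a
    classify-unbounded a (yes p) = contradiction p (proj₂ (holds a))
    classify-unbounded a (no ¬p) = refl
    unclassify : ∀ a d → [ (λ a → refined (value a) (proj₁ (holds a))) , (λ a → refined (value a) (proj₁ (holds a))) ]′ (classify a d) ≡ a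
    unclassify a (yes p) = refl
    unclassify a (no ¬p) = refl

  decomposition-↔ : Carrier ↔ Setoid.Carrier (𝔈 g +ₑ ℭ)
  decomposition-↔ = classify-↔ ⨾ ⊎-cong bounded-↔ (↔-id _)

  decomposition-∼ : ∀ a a′ → value a ∼ value a′ ⇔
    Setoid._≈_ (𝔈 g +ₑ ℭ) (Inverse.to decomposition-↔ a) (Inverse.to decomposition-↔ a′)
  decomposition-∼ a a′ = mk⇔ (preserve em em) (reflect em em)
    where
    open Setoid (𝔈 g +ₑ ℭ) using (_≈_)
    image : (a : Carrier) → Dec (Bounded (value a)) → Setoid.Carrier (𝔈 g +ₑ ℭ)
    image a d = Sum.map (Inverse.to bounded-↔) id (classify a d)

    bounded : (a : Carrier) → Bounded (value a) → BoundedClasses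
    bounded a p = refined (value a) (holds a , p)

    preserve : ∀ d d′ → value a ∼ value a′ → image a d ≈ image a′ d′
    preserve (yes p) (yes p′) a∼a′ = inj₁ (trans (bounded-↔-proj₁ (bounded a p)) (trans
      (representative-unique (rep-representative (bounded a p)) (rep-representative (bounded a′ p′)) a∼a′)
      (sym (bounded-↔-proj₁ (bounded a′ p′)))))
    preserve (yes p) (no ¬p′) a∼a′ = contradiction (Bounded-∼ a∼a′ p) ¬p′
    preserve (no ¬p) (yes p′) a∼a′ = contradiction (Bounded-∼ (∼-sym a∼a′) p′) ¬p
    preserve (no ¬p) (no ¬p′) a∼a′ = inj₂ a∼a′

    reflect : ∀ d d′ → image a d ≈ image a′ d′ → value a ∼ value a′
    reflect (yes p) (yes p′) (inj₁ eq) = representative-∼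
      (subst (λ x → Representative x (value a))
        (trans (sym (bounded-↔-proj₁ (bounded a p))) (trans eq (bounded-↔-proj₁ (bounded a′ p′))))
        (rep-representative (bounded a p)))
      (rep-representative (bounded a′ p′))
    reflect (no ¬p) (no ¬p′) (inj₂ a∼a′) = a∼a′

presburger⇒vpf : ExcludedMiddle 0ℓ → (𝔄 : EquivalenceStructure) → IsPresburger (structure 𝔄) →
  ∃ λ n → Σ (Vec ℕ n → ℕ) λ g → Σ EquivalenceStructure λ ℭ →
    IsGeneralisedVPF g × Countable ℭ × OnlyInfiniteClasses ℭ × structure 𝔄 ≅ structure (𝔈 g +ₑ ℭ)
presburger⇒vpf em 𝔄 (k , τ , iso) = k , g , ℭ , g-gvpf , ℭ-countable , ℭ-infinite , record
  { bijection = carrier-↔ ⨾ decomposition-↔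
  ; preserves = λ { tt (c ∷ c′ ∷ []) → mk⇔
      (λ c≈c′ → Equivalence.to (decomposition-∼ (Inverse.to carrier-↔ c) (Inverse.to carrier-↔ c′))
        (related (to c) (to c′) (Equivalence.to (preserves tt (c ∷ c′ ∷ [])) c≈c′)))
      (λ rel → Equivalence.from (preserves tt (c ∷ c′ ∷ []))
        (proj₂ (proj₂ (Equivalence.from (decomposition-∼ (Inverse.to carrier-↔ c) (Inverse.to carrier-↔ c′)) rel)))) } }
  where
  open Setoid 𝔄 using (_≈_) renaming (refl to ≈-refl; sym to ≈-sym; trans to ≈-trans)
  open Classical em
  open Interpretation τ
  open _≅_ iso
  open Inverse bijection using (to; from; strictlyInverseˡ)

  Domain : Set
  Domain = Refinement (Vec ℕ k) (_⊨ δ)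

  _~_ : Vec ℕ k → Vec ℕ k → Set
  a ~ b = (a Vec.++ b Vec.++ []) ⊨ φ tt

  -- Off the domain the formula for the relation is unconstrained. Adding `δ` on both sides gives a
  -- partial equivalence relation on all of ℕᵏ whose reflexive part is the domain.
  _∼_ : Vec ℕ k → Vec ℕ k → Set
  a ∼ b = a ⊨ δ × b ⊨ δ × a ~ b

  ~⇒≈ : ∀ (r s : Domain) → value r ~ value s → from r ≈ from s
  ~⇒≈ r s r~s = Equivalence.from (preserves tt (from r ∷ from s ∷ []))
    (subst₂ (λ r s → value r ~ value s) (sym (strictlyInverseˡ r)) (sym (strictlyInverseˡ s)) r~s)

  ≈⇒~ : ∀ (r s : Domain) → from r ≈ from s → value r ~ value s
  ≈⇒~ r s r≈s = subst₂ (λ r s → value r ~ value s) (strictlyInverseˡ r) (strictlyInverseˡ s)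
    (Equivalence.to (preserves tt (from r ∷ from s ∷ [])) r≈s)

  related : ∀ (r s : Domain) → value r ~ value s → value r ∼ value s
  related r s r~s = holds r , holds s , r~s

  ∼-sym : ∀ {a b} → a ∼ b → b ∼ a
  ∼-sym (p , q , a~b) = q , p , ≈⇒~ (refined _ q) (refined _ p) (≈-sym (~⇒≈ (refined _ p) (refined _ q) a~b))

  ∼-trans : ∀ {a b c} → a ∼ b → b ∼ c → a ∼ c
  ∼-trans (p , q , a~b) (_ , r , b~c) = p , r , ≈⇒~ (refined _ p) (refined _ r)
    (≈-trans (~⇒≈ (refined _ p) (refined _ q) a~b) (~⇒≈ (refined _ q) (refined _ r) b~c))

  good-∼ : ∀ {n} (σ τ : Vec (Fin n) k) → Good (λ x → (x ‼ σ) ∼ (x ‼ τ))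
  good-∼ σ τ = good-× (good-rename σ (good-⊨ em δ)) (good-× (good-rename τ (good-⊨ em δ))
    (good-map (λ x → subst (_⊨ φ tt) (split-‼ x)) (λ x → subst (_⊨ φ tt) (sym (split-‼ x)))
      (good-rename (σ Vec.++ τ Vec.++ []) (good-⊨ em (φ tt)))))
    where
    split-‼ : ∀ x → x ‼ (σ Vec.++ τ Vec.++ []) ≡ (x ‼ σ) Vec.++ (x ‼ τ) Vec.++ []
    split-‼ x = trans (Vec.map-++ (lookup x) σ (τ Vec.++ [])) (cong ((x ‼ σ) Vec.++_) (Vec.map-++ (lookup x) τ []))

  open Presburger⇒VPF em _∼_ ∼-sym ∼-trans good-∼

  carrier-↔ : Setoid.Carrier 𝔄 ↔ Carrier
  carrier-↔ = bijection ⨾ Refinement-cong-↔ (λ a p → p , p , ≈⇒~ (refined a p) (refined a p) ≈-refl) (λ a → proj₁)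

-- Definability of affine conditions

-- The terms of the language have no constants; literals are recovered from two quantified variables
-- that are forced to be 0 and 1.
data Affine (n : ℕ) : Set where
  ref : Fin n → Affine n
  lit : ℕ → Affine n
  add : Affine n → Affine n → Affine n

⟦_⟧ᵃ : ∀ {n} → Affine n → Vec ℕ n → ℕ
⟦ ref i ⟧ᵃ   ρ = lookup ρ i
⟦ lit k ⟧ᵃ   ρ = k
⟦ add s t ⟧ᵃ ρ = ⟦ s ⟧ᵃ ρ + ⟦ t ⟧ᵃ ρ

-- Variables 0 and 1 hold the constants 0 and 1.
toTerm : ∀ {n} → Affine n → Term (2 + n)
toTerm (ref i)       = var (suc (suc i))
toTerm (lit zero)    = var zero
toTerm (lit (suc k)) = var (suc zero) ⊕ toTerm (lit k)
toTerm (add s t)     = toTerm s ⊕ toTerm t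

eval-toTerm : ∀ {n} (t : Affine n) ρ → eval (0 ∷ 1 ∷ ρ) (toTerm t) ≡ ⟦ t ⟧ᵃ ρ
eval-toTerm (ref i)       ρ = refl
eval-toTerm (lit zero)    ρ = refl
eval-toTerm (lit (suc k)) ρ = cong suc (eval-toTerm (lit k) ρ)
eval-toTerm (add s t)     ρ = cong₂ _+_ (eval-toTerm s ρ) (eval-toTerm t ρ)

is-zero : ∀ {n} → Fin n → Formula n
is-zero i = (var i ⊕ var i) ≐ var i

-- Among the nonzero numbers, 1 is the only one that is not a sum of two nonzero numbers. The
-- implication is written with `¬′` and `∨′`.
is-one : ∀ {n} → Fin n → Formula n
is-one i = (¬′ (is-zero i)) ∧′
  (∀′ (∀′ ((¬′ (var (suc (suc i)) ≐ (var zero ⊕ var (suc zero)))) ∨′ (is-zero zero ∨′ is-zero (suc zero)))))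

k+k≡k⇒k≡0 : ∀ {k} → k + k ≡ k → k ≡ 0
k+k≡k⇒k≡0 {k} eq = ℕ.+-cancelˡ-≡ k k 0 (trans eq (sym (ℕ.+-identityʳ k)))

is-one⇒≡1 : ∀ {n} (ρ : Vec ℕ n) i → ρ ⊨ is-one i → lookup ρ i ≡ 1
is-one⇒≡1 ρ i (≢0 , prime) with lookup ρ i
... | 0 = contradiction refl ≢0
... | 1 = refl
-- `2 + k` is the sum of 1 and `1 + k`, both nonzero.
... | suc (suc k) with prime 1 (suc k)
... | inj₁ ≢ = contradiction (cong suc (ℕ.+-comm 1 k)) ≢
... | inj₂ (inj₁ eq) = contradiction (k+k≡k⇒k≡0 {suc k} eq) λ ()
... | inj₂ (inj₂ ())

1-is-one : ∀ {n} (ρ : Vec ℕ n) i → lookup ρ i ≡ 1 → ρ ⊨ is-one i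
1-is-one ρ i eq rewrite eq = (λ ()) , λ
  { zero          b             → inj₂ (inj₂ refl)
  ; (suc a)       zero          → inj₂ (inj₁ refl)
  ; (suc a)       (suc b)       → inj₁ λ e → contradiction (trans (ℕ.suc-injective e) (ℕ.+-suc b a)) λ () }

-- In contrast to `Good`, this records an actual formula, which an interpretation has to contain.
Definable : ∀ {n} → (Vec ℕ n → Set) → Set
Definable {n} P = Σ (Formula n) λ φ → ∀ ρ → ρ ⊨ φ ⇔ P ρ

module _ {n : ℕ} where

  def-map : ∀ {P Q : Vec ℕ n → Set} → (∀ ρ → P ρ → Q ρ) → (∀ ρ → Q ρ → P ρ) → Definable P → Definable Q
  def-map f g (φ , p) = φ , λ ρ → mk⇔ (f ρ ∘ Equivalence.to (p ρ)) (Equivalence.from (p ρ) ∘ g ρ)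

  def-≡ : ∀ s t → Definable {n} (λ ρ → ⟦ s ⟧ᵃ ρ ≡ ⟦ t ⟧ᵃ ρ)
  def-≡ s t = ∃′ (∃′ (is-zero zero ∧′ (is-one (suc zero) ∧′ (toTerm s ≐ toTerm t)))) , λ ρ → mk⇔
    (λ { (o , z , z+z≡z , one , eq) → sound ρ (k+k≡k⇒k≡0 z+z≡z) (is-one⇒≡1 (z ∷ o ∷ ρ) (suc zero) one) eq })
    (λ eq → 1 , 0 , refl , 1-is-one (0 ∷ 1 ∷ ρ) (suc zero) refl
          , trans (eval-toTerm s ρ) (trans eq (sym (eval-toTerm t ρ))))
    where
    sound : ∀ ρ {z o} → z ≡ 0 → o ≡ 1 → eval (z ∷ o ∷ ρ) (toTerm s) ≡ eval (z ∷ o ∷ ρ) (toTerm t) → ⟦ s ⟧ᵃ ρ ≡ ⟦ t ⟧ᵃ ρ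
    sound ρ refl refl eq = trans (sym (eval-toTerm s ρ)) (trans eq (eval-toTerm t ρ))

  def-⊤ : Definable {n} (λ _ → ⊤)
  def-⊤ = def-map (λ _ _ → tt) (λ _ _ → refl) (def-≡ (lit 0) (lit 0))

  def-⊥ : Definable {n} (λ _ → ⊥)
  def-⊥ = def-map (λ _ ()) (λ _ ()) (def-≡ (lit 0) (lit 1))

  def-× : ∀ {P Q : Vec ℕ n → Set} → Definable P → Definable Q → Definable (λ ρ → P ρ × Q ρ)
  def-× (φ , p) (ψ , q) = φ ∧′ ψ , λ ρ → mk⇔
    (λ (a , b) → Equivalence.to (p ρ) a , Equivalence.to (q ρ) b)
    (λ (a , b) → Equivalence.from (p ρ) a , Equivalence.from (q ρ) b)

  def-⊎ : ∀ {P Q : Vec ℕ n → Set} → Definable P → Definable Q → Definable (λ ρ → P ρ ⊎ Q ρ)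
  def-⊎ (φ , p) (ψ , q) = φ ∨′ ψ , λ ρ → mk⇔
    (Sum.map (Equivalence.to (p ρ)) (Equivalence.to (q ρ)))
    (Sum.map (Equivalence.from (p ρ)) (Equivalence.from (q ρ)))

  def-∃ : ∀ {P : Vec ℕ (suc n) → Set} → Definable P → Definable (λ ρ → ∃ λ x → P (x ∷ ρ))
  def-∃ (φ , p) = ∃′ φ , λ ρ → mk⇔ (λ (x , a) → x , Equivalence.to (p (x ∷ ρ)) a)
                                   (λ (x , a) → x , Equivalence.from (p (x ∷ ρ)) a)

  def-any : ∀ {k} {P : Fin k → Vec ℕ n → Set} → (∀ i → Definable (P i)) → Definable (λ ρ → ∃ λ i → P i ρ)
  def-any {zero}  p = def-map (λ _ ()) (λ { _ (() , _) }) def-⊥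
  def-any {suc k} p = def-map
    (λ { ρ (inj₁ a) → zero , a ; ρ (inj₂ (i , a)) → suc i , a })
    (λ { ρ (zero , a) → inj₁ a ; ρ (suc i , a) → inj₂ (i , a) })
    (def-⊎ (p zero) (def-any (p ∘ suc)))

  ⟦_⟧* : ∀ {k} → Vec (Affine n) k → Vec ℕ n → Vec ℕ k
  ⟦ ts ⟧* ρ = map (λ t → ⟦ t ⟧ᵃ ρ) ts

  def-≡* : ∀ {k} (ss ts : Vec (Affine n) k) → Definable (λ ρ → ⟦ ss ⟧* ρ ≡ ⟦ ts ⟧* ρ)
  def-≡* []       []       = def-map (λ _ _ → refl) (λ _ _ → tt) def-⊤
  def-≡* (s ∷ ss) (t ∷ ts) = def-map
    (λ ρ (p , q) → cong₂ _∷_ p q) (λ ρ eq → cong Vec.head eq , cong Vec.tail eq)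
    (def-× (def-≡ s t) (def-≡* ss ts))

  def-shift : ∀ {k} (ss : Vec (Affine n) k) c ts → Definable (λ ρ → shift (⟦ ss ⟧* ρ) c ≡ map +_ (⟦ ts ⟧* ρ))
  def-shift []       []      []       = def-map (λ _ _ → refl) (λ _ _ → tt) def-⊤
  def-shift (s ∷ ss) (c ∷ cs) (t ∷ ts) = def-map
    (λ ρ (p , q) → cong₂ _∷_ p q) (λ ρ eq → cong Vec.head eq , cong Vec.tail eq)
    (def-× (def-add c) (def-shift ss cs ts))
    where
    def-add : ∀ c → Definable (λ ρ → + ⟦ s ⟧ᵃ ρ ℤ.+ c ≡ + ⟦ t ⟧ᵃ ρ)
    def-add (+ k)    = def-map (λ ρ eq → cong +_ eq) (λ ρ → ℤ.+-injective) (def-≡ (add s (lit k)) t)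
    -- A negative shift moves to the other side of the equation, so that only addition occurs.
    def-add -[1+ k ] = def-map
      (λ ρ eq → trans (cong (λ j → + j ℤ.+ -[1+ k ]) eq) (identity (+ ⟦ t ⟧ᵃ ρ) (+ suc k)))
      (λ ρ eq → ℤ.+-injective (trans (identity′ (+ ⟦ s ⟧ᵃ ρ) (+ suc k)) (cong (ℤ._+ + suc k) eq)))
      (def-≡ s (add t (lit (suc k))))
      where
      identity : ∀ t k → t ℤ.+ k ℤ.+ ℤ.- k ≡ t
      identity = solve-∀
      identity′ : ∀ s k → s ≡ s ℤ.+ ℤ.- k ℤ.+ k
      identity′ = solve-∀

  scale : ℕ → Affine n → Affine n
  scale zero    t = lit 0
  scale (suc k) t = add t (scale k t)

  ⟦scale⟧ : ∀ k t ρ → ⟦ scale k t ⟧ᵃ ρ ≡ k * ⟦ t ⟧ᵃ ρ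
  ⟦scale⟧ zero    t ρ = refl
  ⟦scale⟧ (suc k) t ρ = cong (λ j → ⟦ t ⟧ᵃ ρ + j) (⟦scale⟧ k t ρ)

  dot : ∀ {m} → Vec ℕ m → Vec (Affine n) m → Affine n
  dot []       []       = lit 0
  dot (a ∷ as) (t ∷ ts) = add (scale a t) (dot as ts)

  ⟦dot⟧ : ∀ {m} (as : Vec ℕ m) ts ρ → ⟦ dot as ts ⟧ᵃ ρ ≡ sum (zipWith _*_ as (⟦ ts ⟧* ρ))
  ⟦dot⟧ []       []       ρ = refl
  ⟦dot⟧ (a ∷ as) (t ∷ ts) ρ = cong₂ _+_ (⟦scale⟧ a t ρ) (⟦dot⟧ as ts ρ)

  ⟦dots⟧ : ∀ {m k} (A : Matrix k m) ts ρ → ⟦ map (λ row → dot row ts) A ⟧* ρ ≡ A *ᵥ ⟦ ts ⟧* ρ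
  ⟦dots⟧ []      ts ρ = refl
  ⟦dots⟧ (r ∷ A) ts ρ = cong₂ _∷_ (⟦dot⟧ r ts ρ) (⟦dots⟧ A ts ρ)

⟦ref⟧ : ∀ {n k} (σ : Vec (Fin n) k) ρ → ⟦ map ref σ ⟧* ρ ≡ ρ ‼ σ
⟦ref⟧ σ ρ = sym (Vec.map-∘ _ ref σ)

map-truncate : ∀ {A B : Set} {m n} (f : A → B) (le : m ≤ n) (v : Vec A n) → map f (truncate le v) ≡ truncate le (map f v)
map-truncate f z≤n      v       = refl
map-truncate f (s≤s le) (x ∷ v) = cong (f x ∷_) (map-truncate f le v)

map-padRight : ∀ {A B : Set} {m n} (f : A → B) (le : m ≤ n) a (v : Vec A m) → map f (padRight le a v) ≡ padRight le (f a) (map f v)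
map-padRight f z≤n      a []      = Vec.map-replicate f a _
map-padRight f (s≤s le) a (x ∷ v) = cong (f x ∷_) (map-padRight f le a v)

≤-sum-tabulate : ∀ {k} (f : Fin k → ℕ) i → f i ≤ sum (tabulate f)
≤-sum-tabulate f zero    = ℕ.m≤m+n _ _
≤-sum-tabulate f (suc i) = ℕ.≤-trans (≤-sum-tabulate (f ∘ suc) i) (ℕ.m≤n+m _ (f zero))

-- Countable structures with only infinite classes

module InfiniteClasses (em : ExcludedMiddle 0ℓ) (ℭ : EquivalenceStructure)
  (countable : Countable ℭ) (infinite : OnlyInfiniteClasses ℭ) where
  open Classical em
  open Setoid ℭ renaming (refl to ≈-refl; sym to ≈-sym; trans to ≈-trans)
  open Injection countable using () renaming (to to code; injective to code-injective)

  Class : Carrier → Set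
  Class c = Refinement Carrier (c ≈_)

  class-↔ : ∀ c → Class c ↔ ℕ
  class-↔ c with countable-↔ (mk↣ {to = code ∘ value} (refinement-≡ ∘ code-injective))
  ... | inj₁ finite = contradiction finite (infinite c)
  ... | inj₂ f      = f

  first : ∀ c → ∃ λ m → (∃ λ y → c ≈ y × code y ≡ m) × (∀ k → (∃ λ y → c ≈ y × code y ≡ k) → m ≤ k)
  first c = least (λ m → ∃ λ y → c ≈ y × code y ≡ m) (code c , c , ≈-refl , refl)

  canonical : Carrier → Carrier
  canonical c = proj₁ (proj₁ (proj₂ (first c)))

  ≈-canonical : ∀ c → c ≈ canonical c
  ≈-canonical c = proj₁ (proj₂ (proj₁ (proj₂ (first c))))

  canonical-cong : ∀ {c c′} → c ≈ c′ → canonical c ≡ canonical c′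
  canonical-cong {c} {c′} c≈c′ = code-injective (ℕ.≤-antisym (smaller c≈c′) (smaller (≈-sym c≈c′)))
    where
    smaller : ∀ {c c′} → c ≈ c′ → code (canonical c) ≤ code (canonical c′)
    smaller {c} {c′} c≈c′ with first c
    ... | m , (y , _ , refl) , m≤ = m≤ _ (canonical c′ , ≈-trans c≈c′ (≈-canonical c′) , refl)

  canonical⇒≈ : ∀ {c c′} → canonical c ≡ canonical c′ → c ≈ c′
  canonical⇒≈ {c} {c′} eq = ≈-trans (≈-canonical c) (subst (_≈ c′) (sym eq) (≈-sym (≈-canonical c′)))

  Classes : Set
  Classes = Refinement Carrier (λ c → canonical c ≡ c)

  class-of : Carrier → Classes
  class-of c = refined (canonical c) (sym (canonical-cong (≈-canonical c)))

  -- Every class is countable and not finite, hence in bijection with ℕ; up to isomorphism only the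
  -- set of classes matters.
  elements-↔ : Carrier ↔ (Classes × ℕ)
  elements-↔ = by-class ⨾ Σ-cong₂-↔ (class-↔ ∘ value)
    where
    collect : ∀ {r r′ : Classes} {y} .{p : value r ≈ y} .{p′} → value r ≡ value r′ →
              _≡_ {A = Σ Classes (Class ∘ value)} (r , refined y p) (r′ , refined y p′)
    collect refl = refl

    by-class : Carrier ↔ Σ Classes (Class ∘ value)
    by-class = mk↔ₛ′ (λ c → class-of c , refined c (≈-sym (≈-canonical c))) (λ (r , y) → value y)
      (λ (r , y) → collect (trans (canonical-cong (≈-sym (holds y))) (holds r)))
      (λ _ → refl)

  ≈⇔same-class : ∀ c c′ → c ≈ c′ ⇔ proj₁ (Inverse.to elements-↔ c) ≡ proj₁ (Inverse.to elements-↔ c′)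
  ≈⇔same-class c c′ = mk⇔ (refinement-≡ ∘ canonical-cong) (canonical⇒≈ ∘ cong value)

  -- There are finitely or countably infinitely many classes, so their numbers form an initial
  -- segment of ℕ or all of ℕ, a definable set in either case. The value 0 is reserved for tuples
  -- that code solutions, hence the `suc`.
  record Numbering : Set where
    field
      number           : Classes → ℕ
      number-injective : ∀ {r r′} → number r ≡ number r′ → r ≡ r′
      def-number       : ∀ {n} (i : Fin n) → Definable (λ ρ → ∃ λ r → lookup ρ i ≡ suc (number r))

  numbering : Numbering
  numbering with countable-↔ (mk↣ {to = code ∘ value {P = λ c → canonical c ≡ c}} (refinement-≡ ∘ code-injective))
  ... | inj₁ (n , f) = record
    { number = toℕ ∘ to
    ; number-injective = λ eq → trans (sym (strictlyInverseʳ _)) (trans (cong from (Fin.toℕ-injective eq)) (strictlyInverseʳ _))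
    ; def-number = λ i → def-map
        (λ { ρ (k , eq) → from k , trans eq (cong (suc ∘ toℕ) (sym (strictlyInverseˡ k))) })
        (λ { ρ (r , eq) → to r , eq })
        (def-any {k = n} (λ k → def-≡ (ref i) (lit (suc (toℕ k))))) }
    where open Inverse f using (to; from; strictlyInverseˡ; strictlyInverseʳ)
  ... | inj₂ f = record
    { number = to
    ; number-injective = λ eq → trans (sym (strictlyInverseʳ _)) (trans (cong from eq) (strictlyInverseʳ _))
    ; def-number = λ i → def-map
        (λ { ρ (k , eq) → from k , trans eq (trans (ℕ.+-comm k 1) (cong suc (sym (strictlyInverseˡ k)))) })
        (λ { ρ (r , eq) → to r , trans eq (ℕ.+-comm 1 _) })
        (def-∃ (def-≡ (ref (suc i)) (add (ref zero) (lit 1)))) }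
    where open Inverse f using (to; from; strictlyInverseˡ; strictlyInverseʳ)

-- The solution y of the i-th system at x is coded by the tuple (i , 0 , x , y), and the e-th element
-- of the j-th infinite class by (e , 1 + j , 0 , 0), where y is padded to a common length.
module VPF⇒Presburger (em : ExcludedMiddle 0ℓ) {n} {g : Vec ℕ n → ℕ} (gvpf : IsGeneralisedVPF g)
  (ℭ : EquivalenceStructure) (countable : Countable ℭ) (infinite : OnlyInfiniteClasses ℭ) where
  open Classical em
  open PartitionFunctions em
  open IsGeneralisedVPF gvpf
  open InfiniteClasses em ℭ countable infinite
  open Numbering numbering

  -- The sum serves as a common upper bound of all `m i`, so that solutions of different systems fit
  -- into tuples of one length.
  M : ℕ
  M = sum (tabulate m)

  m≤M : ∀ i → m i ≤ M
  m≤M = ≤-sum-tabulate m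

  N : ℕ
  N = suc (suc n + M)

  class-indices : Vec (Fin N) (suc n)
  class-indices = map suc (front (suc n))

  x-indices : Vec (Fin N) n
  x-indices = Vec.tail class-indices

  y-indices : Vec (Fin N) M
  y-indices = map suc (back (suc n))

  tuple : ℕ → Vec ℕ (suc n) → Vec ℕ M → Vec ℕ N
  tuple tag z y = tag ∷ z Vec.++ y

  tuple-class : ∀ tag z y → tuple tag z y ‼ class-indices ≡ z
  tuple-class tag z y = trans (‼-suc tag (z Vec.++ y) (front (suc n))) (‼-front z y)

  tuple-y : ∀ tag z y → tuple tag z y ‼ y-indices ≡ y
  tuple-y tag z y = trans (‼-suc tag (z Vec.++ y) (back (suc n))) (‼-back z y)

  tuple-surjective : ∀ t → ∃ λ tag → ∃ λ z → ∃ λ y → t ≡ tuple tag z y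
  tuple-surjective (tag ∷ v) = tag , take (suc n) v , drop (suc n) v , cong (tag ∷_) (sym (Vec.take++drop≡id (suc n) v))

  tuple-injective : ∀ {tag tag′} z z′ {y y′} → tuple tag z y ≡ tuple tag′ z′ y′ → tag ≡ tag′ × z ≡ z′ × y ≡ y′
  tuple-injective z z′ eq = cong Vec.head eq , Vec.++-injective z z′ (cong Vec.tail eq)

  -- The equation with `padRight` forces the entries after the first `m i` to be 0, so every
  -- solution has exactly one code.
  SolutionTuple : Fin s → ℕ → Vec ℕ (suc n) → Vec ℕ M → Set
  SolutionTuple i tag (j ∷ x) y = tag ≡ toℕ i × j ≡ 0 × y ≡ padRight (m≤M i) 0 (truncate (m≤M i) y) ×
                                  shift x (c i) ≡ map +_ (A i *ᵥ truncate (m≤M i) y)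

  ElementTuple : Vec ℕ (suc n) → Vec ℕ M → Set
  ElementTuple (j ∷ x) y = (∃ λ r → j ≡ suc (number r)) × x ≡ origin × y ≡ origin

  Tuple : ℕ → Vec ℕ (suc n) → Vec ℕ M → Set
  Tuple tag z y = (∃ λ i → SolutionTuple i tag z y) ⊎ ElementTuple z y

  def-Tuple : Definable (λ t → Tuple (lookup t zero) (t ‼ class-indices) (t ‼ y-indices))
  def-Tuple = def-⊎
    (def-any λ i → def-× (def-≡ (ref zero) (lit (toℕ i))) (def-× (def-≡ (ref (suc zero)) (lit 0)) (def-× (padded i) (solution i))))
    (def-× (def-number (suc zero)) (def-× (vanishes x-indices) (vanishes y-indices)))
    where
    y-terms : ∀ i → Vec (Affine N) (m i)
    y-terms i = map ref (truncate (m≤M i) y-indices)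

    ⟦y-terms⟧ : ∀ i t → ⟦ y-terms i ⟧* t ≡ truncate (m≤M i) (t ‼ y-indices)
    ⟦y-terms⟧ i t = trans (⟦ref⟧ (truncate (m≤M i) y-indices) t) (map-truncate (lookup t) (m≤M i) y-indices)

    padded : ∀ i → Definable (λ t → t ‼ y-indices ≡ padRight (m≤M i) 0 (truncate (m≤M i) (t ‼ y-indices)))
    padded i = def-map (λ t → subst₂ _≡_ (⟦ref⟧ y-indices t) (pad t)) (λ t → subst₂ _≡_ (sym (⟦ref⟧ y-indices t)) (sym (pad t)))
      (def-≡* (map ref y-indices) (padRight (m≤M i) (lit 0) (y-terms i)))
      where
      pad : ∀ t → ⟦ padRight (m≤M i) (lit 0) (y-terms i) ⟧* t ≡ padRight (m≤M i) 0 (truncate (m≤M i) (t ‼ y-indices))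
      pad t = trans (map-padRight _ (m≤M i) (lit 0) (y-terms i)) (cong (padRight (m≤M i) 0) (⟦y-terms⟧ i t))

    solution : ∀ i → Definable (λ t → shift (t ‼ x-indices) (c i) ≡ map +_ (A i *ᵥ truncate (m≤M i) (t ‼ y-indices)))
    solution i = def-map (λ t → subst₂ (λ x v → shift x (c i) ≡ map +_ v) (⟦ref⟧ x-indices t) (product-value t))
      (λ t → subst₂ (λ x v → shift x (c i) ≡ map +_ v) (sym (⟦ref⟧ x-indices t)) (sym (product-value t)))
      (def-shift (map ref x-indices) (c i) (map (λ row → dot row (y-terms i)) (A i)))
      where
      product-value : ∀ t → ⟦ map (λ row → dot row (y-terms i)) (A i) ⟧* t ≡ A i *ᵥ truncate (m≤M i) (t ‼ y-indices)
      product-value t = trans (⟦dots⟧ (A i) (y-terms i) t) (cong (A i *ᵥ_) (⟦y-terms⟧ i t))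

    vanishes : ∀ {k} (σ : Vec (Fin N) k) → Definable (λ t → t ‼ σ ≡ origin)
    vanishes σ = def-map (λ t → subst₂ _≡_ (⟦ref⟧ σ t) (Vec.map-replicate _ (lit 0) _))
      (λ t → subst₂ _≡_ (sym (⟦ref⟧ σ t)) (sym (Vec.map-replicate _ (lit 0) _)))
      (def-≡* (map ref σ) (replicate _ (lit 0)))

  Elements : Set
  Elements = Σ (Vec ℕ n) (λ x → Σ (Fin s) (Solution gvpf x)) ⊎ (Classes × ℕ)

  -- The leading entry separates the two summands and the infinite classes from each other, so that
  -- equivalence is equality of these vectors, a definable condition on the codes.
  class : Elements → Vec ℕ (suc n)
  class (inj₁ (x , i , y)) = 0 ∷ x
  class (inj₂ (r , e))     = suc (number r) ∷ origin

  code-tuple : Elements → Vec ℕ N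
  code-tuple (inj₁ (x , i , y)) = tuple (toℕ i) (0 ∷ x) (padRight (m≤M i) 0 (value y))
  code-tuple (inj₂ (r , e))     = tuple e (suc (number r) ∷ origin) origin

  code-tuple-class : ∀ a → code-tuple a ‼ class-indices ≡ class a
  code-tuple-class (inj₁ (x , i , y)) = tuple-class _ _ _
  code-tuple-class (inj₂ (r , e))     = tuple-class _ _ _

  code-tuple-injective : ∀ {a a′} → code-tuple a ≡ code-tuple a′ → a ≡ a′
  code-tuple-injective {inj₁ (x , i , y)} {inj₁ (x′ , i′ , y′)} eq with tuple-injective (0 ∷ x) (0 ∷ x′) eq
  ... | tag , refl , pad with Fin.toℕ-injective tag
  ... | refl = cong (λ y → inj₁ (x , i , y)) (refinement-≡ (trans (sym (Vec.truncate-padRight (m≤M i) 0 (value y)))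
                 (trans (cong (truncate (m≤M i)) pad) (Vec.truncate-padRight (m≤M i) 0 (value y′)))))
  code-tuple-injective {inj₁ (x , i , y)} {inj₂ (r , e)} eq =
    contradiction (cong (Vec.head ∘ Vec.tail) eq) λ ()
  code-tuple-injective {inj₂ (r , e)} {inj₁ (x , i , y)} eq =
    contradiction (cong (Vec.head ∘ Vec.tail) eq) λ ()
  code-tuple-injective {inj₂ (r , e)} {inj₂ (r′ , e′)} eq with cong Vec.head eq
  ... | refl = cong (λ r → inj₂ (r , e)) (number-injective (ℕ.suc-injective (cong (Vec.head ∘ Vec.tail) eq)))

  code-tuple-Tuple : ∀ a → ∃ λ tag → ∃ λ z → ∃ λ y → code-tuple a ≡ tuple tag z y × Tuple tag z y
  code-tuple-Tuple (inj₁ (x , i , y)) = toℕ i , 0 ∷ x , padRight (m≤M i) 0 (value y) , refl , inj₁ (i , refl , refl ,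
    cong (padRight (m≤M i) 0) (sym (Vec.truncate-padRight (m≤M i) 0 (value y))) ,
    subst (λ v → shift x (c i) ≡ map +_ (A i *ᵥ v)) (sym (Vec.truncate-padRight (m≤M i) 0 (value y))) (holds y))
  code-tuple-Tuple (inj₂ (r , e)) = e , suc (number r) ∷ origin , origin , refl , inj₂ ((r , refl) , refl , refl)

  Tuple-code-tuple : ∀ tag z y → Tuple tag z y → ∃ λ a → code-tuple a ≡ tuple tag z y
  Tuple-code-tuple _ (_ ∷ x) y (inj₁ (i , refl , refl , pad , eq)) =
    inj₁ (x , i , refined (truncate (m≤M i) y) eq) , cong (tuple (toℕ i) (0 ∷ x)) (sym pad)
  Tuple-code-tuple e (_ ∷ _) _ (inj₂ ((r , refl) , refl , refl)) = inj₂ (r , e) , refl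

  τ : Interpretation ∼-signature N
  τ = record
    { δ = proj₁ def-Tuple
    -- `concat` lays out a pair of tuples as `t ++ t′ ++ []`, so the second tuple sits in the last
    -- `N + 0` places.
    ; φ = λ _ → proj₁ (def-≡* (map ref (map (_↑ˡ (N + 0)) class-indices)) (map ref (map (N ↑ʳ_) (map (_↑ˡ 0) class-indices)))) }

  code-↔ : Elements ↔ Refinement (Vec ℕ N) (_⊨ proj₁ def-Tuple)
  code-↔ = image-↔ code-tuple code-tuple-injective
    (λ a → let (tag , z , y , eq , t) = code-tuple-Tuple a in
       subst (_⊨ proj₁ def-Tuple) (sym eq) (Equivalence.from (proj₂ def-Tuple (tuple tag z y))
         (subst₂ (Tuple tag) (sym (tuple-class tag z y)) (sym (tuple-y tag z y)) t)))
    (λ t sat → let (tag , z , y , eq) = tuple-surjective t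
                   (a , eq′) = Tuple-code-tuple tag z y (subst₂ (Tuple tag) (tuple-class tag z y) (tuple-y tag z y)
                                 (Equivalence.to (proj₂ def-Tuple (tuple tag z y)) (subst (_⊨ proj₁ def-Tuple) eq sat)))
               in a , trans eq′ (sym eq))

  φ-correct : ∀ t t′ → (t Vec.++ t′ Vec.++ []) ⊨ Interpretation.φ τ tt ⇔ t ‼ class-indices ≡ t′ ‼ class-indices
  φ-correct t t′ = mk⇔
    (λ sat → trans (sym first-class) (trans (Equivalence.to (proj₂ definition ρ) sat) second-class))
    (λ eq → Equivalence.from (proj₂ definition ρ) (trans first-class (trans eq (sym second-class))))
    where
    ρ = t Vec.++ t′ Vec.++ []
    σ = map (_↑ˡ (N + 0)) class-indices
    σ′ = map (N ↑ʳ_) (map (_↑ˡ 0) class-indices)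
    definition = def-≡* (map ref σ) (map ref σ′)

    ‼-++ˡ : ∀ {m n k} (v : Vec ℕ m) (w : Vec ℕ n) (σ : Vec (Fin m) k) → (v Vec.++ w) ‼ map (_↑ˡ n) σ ≡ v ‼ σ
    ‼-++ˡ v w σ = trans (sym (Vec.map-∘ (lookup (v Vec.++ w)) (_↑ˡ _) σ)) (Vec.map-cong (Vec.lookup-++ˡ v w) σ)

    first-class : ⟦ map ref σ ⟧* ρ ≡ t ‼ class-indices
    first-class = trans (⟦ref⟧ σ ρ) (‼-++ˡ t (t′ Vec.++ []) class-indices)

    second-class : ⟦ map ref σ′ ⟧* ρ ≡ t′ ‼ class-indices
    second-class = trans (⟦ref⟧ σ′ ρ) (trans (‼-weaken t (t′ Vec.++ []) (map (_↑ˡ 0) class-indices)) (‼-++ˡ t′ [] class-indices))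

  sum-↔ : Setoid.Carrier (𝔈 g +ₑ ℭ) ↔ Elements
  sum-↔ = ⊎-cong (solutions-↔ gvpf) elements-↔

  same-class : ∀ p q → Setoid._≈_ (𝔈 g +ₑ ℭ) p q ⇔ class (Inverse.to sum-↔ p) ≡ class (Inverse.to sum-↔ q)
  same-class (inj₁ p) (inj₁ q) = mk⇔ (λ { (inj₁ eq) → cong (0 ∷_) eq }) (λ eq → inj₁ (cong Vec.tail eq))
  same-class (inj₁ p) (inj₂ q) = mk⇔ (λ ()) (λ eq → contradiction (cong Vec.head eq) λ ())
  same-class (inj₂ p) (inj₁ q) = mk⇔ (λ ()) (λ eq → contradiction (cong Vec.head eq) λ ())
  same-class (inj₂ p) (inj₂ q) = mk⇔
    (λ { (inj₂ p≈q) → cong (λ r → suc (number r) ∷ origin) (Equivalence.to (≈⇔same-class p q) p≈q) })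
    (λ eq → inj₂ (Equivalence.from (≈⇔same-class p q) (number-injective (ℕ.suc-injective (cong Vec.head eq)))))

  presburger : (𝔄 : EquivalenceStructure) → structure 𝔄 ≅ structure (𝔈 g +ₑ ℭ) → IsPresburger (structure 𝔄)
  presburger 𝔄 iso = N , τ , record
    { bijection = bijection ⨾ sum-↔ ⨾ code-↔
    ; preserves = λ { tt (a ∷ a′ ∷ []) → mk⇔
        (λ a≈a′ → Equivalence.to (related (to a) (to a′)) (Equivalence.to (preserves tt (a ∷ a′ ∷ [])) a≈a′))
        (λ sat → Equivalence.from (preserves tt (a ∷ a′ ∷ [])) (Equivalence.from (related (to a) (to a′)) sat)) } }
    where
    open _≅_ iso
    open Inverse bijection using (to)

    tuple-of : Setoid.Carrier (𝔈 g +ₑ ℭ) → Vec ℕ N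
    tuple-of = code-tuple ∘ Inverse.to sum-↔

    related : ∀ p q → Setoid._≈_ (𝔈 g +ₑ ℭ) p q ⇔ (tuple-of p Vec.++ tuple-of q Vec.++ []) ⊨ Interpretation.φ τ tt
    related p q = mk⇔
      (λ p≈q → Equivalence.from (φ-correct (tuple-of p) (tuple-of q)) (trans (code-tuple-class (Inverse.to sum-↔ p))
        (trans (Equivalence.to (same-class p q) p≈q) (sym (code-tuple-class (Inverse.to sum-↔ q))))))
      (λ sat → Equivalence.from (same-class p q) (trans (sym (code-tuple-class (Inverse.to sum-↔ p)))
        (trans (Equivalence.to (φ-correct (tuple-of p) (tuple-of q)) sat) (code-tuple-class (Inverse.to sum-↔ q)))))

theorem6p2 : ExcludedMiddle 0ℓ → (𝔄 : EquivalenceStructure) →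
    IsPresburger (structure 𝔄)
    ⇔ (∃ λ n → Σ (Vec ℕ n → ℕ) λ g → Σ EquivalenceStructure λ ℭ →
    IsGeneralisedVPF g × Countable ℭ × OnlyInfiniteClasses ℭ
    × structure 𝔄 ≅ structure (𝔈 g +ₑ ℭ))
theorem6p2 em 𝔄 = mk⇔ (presburger⇒vpf em 𝔄)
  (λ (n , g , ℭ , gvpf , countable , infinite , iso) → VPF⇒Presburger.presburger em gvpf ℭ countable infinite 𝔄 iso)
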